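{- Let $G=(V,E)$ be an undirected graph with $m$ edges and let $\mu$ be an orientation of its edges. Procedure AD Paths Decomposition partitions $E$ into a collection $\mathcal D$ of edge-disjoint alternating-directions paths such that each vertex $v\in V$ is an incoming endpoint of at most one path in $\mathcal D$ and an outgoing endpoint of at most one path in $\mathcal D$. The procedure requires $O(m)$ time.
   Context: A path here is a trail $P=(v_0,e_1,v_1,\dots,e_k,v_k)$ (a walk with pairwise distinct edges, vertices may repeat; if $v_0=v_k$ it is called a cycle). $P$ is an alternating-directions (AD) path if for every $1\le i<k$, the edges $e_i,e_{i+1}$ are either both oriented (under $\mu$) towards $v_i$ or both oriented away from $v_i$. $v_0$ is an incoming endpoint of $P$ if $e_1$ is oriented towards $v_0$, and an outgoing endpoint otherwise; symmetrically $v_k$ is an incoming endpoint if $e_k$ is oriented towards $v_k$, and an outgoing endpoint otherwise. An AD path $P$ in a graph $H$ is maximal if every edge of $H$ incident to $v_0$ oriented in the same direction relative to $v_0$ as $e_1$ belongs to $P$, and every edge of $H$ incident to $v_k$ oriented in the same direction relative to $v_k$ as $e_k$ belongs to $P$. Procedure AD Paths Decomposition$(G,\mu)$: set $\mathcal D=\emptyset$, $\mathcal F=E$; while $\mathcal F\ne\emptyset$, compute a maximal AD path $P$ in the graph $(V,\mathcal F)$ with the orientation induced by $\mu$, add $P$ to $\mathcal D$ and delete the edges of $P$ from $\mathcal F$; return $\mathcal D$. -}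

module Defs where

open import Data.Bool.Base using (Bool; true; false; if_then_else_)
open import Data.Fin.Base using (Fin; toℕ; inject₁; fromℕ) renaming (zero to fzero; suc to fsuc)
open import Data.Fin.Subset using (Subset; _∈_; _─_; ⋃; ⁅_⁆; ⊤; Nonempty; Empty)
open import Data.List.Base using (List; []; _∷_; _∷ʳ_; length; lookup; concatMap; tabulate; applyUpTo)
open import Data.Nat.Base using (ℕ; zero; suc; pred; _+_; _≡ᵇ_; _<ᵇ_)
open import Data.Product using (_×_; _,_; ∃; ∃!)
open import Data.Sum.Base using (_⊎_)
open import Data.Vec.Base as Vec using (Vec; []; _∷_)
open import Data.Vec.Membership.Propositional using () renaming (_∈_ to _∈ᵛ_)
open import Data.Vec.Relation.Unary.All using (All)
open import Data.Vec.Relation.Unary.Unique.Propositional using (Unique)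
open import Function.Base using (_∘_)
open import Relation.Binary.Construct.Closure.ReflexiveTransitive using (Star)
open import Relation.Binary.PropositionalEquality using (_≡_; _≢_)
open import Relation.Nullary.Negation using (¬_)

-- The vertex set is Fin n and the edge set is Fin m.  `ends e` lists the two
-- endpoints of e in an order without significance.  There are no loops;
-- parallel edges are not excluded.
record Graph (n m : ℕ) : Set where
  field
    ends     : Fin m → Fin n × Fin n
    loopless : ∀ e u v → ends e ≡ (u , v) → u ≢ v

Joins : ∀ {n m} → Graph n m → Fin m → Fin n → Fin n → Set
Joins G e u v = (Graph.ends G e ≡ (u , v)) ⊎ (Graph.ends G e ≡ (v , u))

record Orientation {n m : ℕ} (G : Graph n m) : Set where
  field
    tail  : Fin m → Fin n
    head  : Fin m → Fin n
    joins : ∀ e → Joins G e (tail e) (head e)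

-- A sequence (v₀, e₁, v₁, …, e_k, v_k) with k = suc ℓ ≥ 1, so that the first
-- and the last edge exist.  `Vec.lookup edges i` is e_{i+1}.
record Path (n m : ℕ) : Set where
  field
    ℓ        : ℕ
    vertices : Vec (Fin n) (suc (suc ℓ))
    edges    : Vec (Fin m) (suc ℓ)

  vertex : Fin (suc (suc ℓ)) → Fin n
  vertex = Vec.lookup vertices

  edge : Fin (suc ℓ) → Fin m
  edge = Vec.lookup edges

  startVertex endVertex : Fin n
  startVertex = vertex fzero
  endVertex   = vertex (fromℕ (suc ℓ))

  firstEdge lastEdge : Fin m
  firstEdge = edge fzero
  lastEdge  = edge (fromℕ ℓ)

  edgeSet : Subset m
  edgeSet = ⋃ (Vec.toList (Vec.map ⁅_⁆ edges))

open Path public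

module _ {n m : ℕ} {G : Graph n m} (μ : Orientation G) where
  open Orientation μ

  Towards Away : Fin m → Fin n → Set
  Towards e v = head e ≡ v
  Away    e v = tail e ≡ v

  SameDirection : Fin n → Fin m → Fin m → Set
  SameDirection v e f = (Towards e v × Towards f v) ⊎ (Away e v × Away f v)

  record IsADPath (P : Path n m) : Set where
    field
      walk        : ∀ i → Joins G (edge P i) (vertex P (inject₁ i)) (vertex P (fsuc i))
      distinct    : Unique (edges P)
      alternating : ∀ (i : Fin (ℓ P)) →
                    SameDirection (vertex P (fsuc (inject₁ i))) (edge P (inject₁ i)) (edge P (fsuc i))

  IncomingEndpoint OutgoingEndpoint : Fin n → Path n m → Set
  IncomingEndpoint v P = (v ≡ startVertex P × Towards (firstEdge P) v)
                       ⊎ (v ≡ endVertex P × Towards (lastEdge P) v)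
  OutgoingEndpoint v P = (v ≡ startVertex P × ¬ Towards (firstEdge P) v)
                       ⊎ (v ≡ endVertex P × ¬ Towards (lastEdge P) v)

  record IsMaximalADPath (F : Subset m) (P : Path n m) : Set where
    field
      isADPath   : IsADPath P
      inF        : All (_∈ F) (edges P)
      maxAtStart : ∀ f → f ∈ F → SameDirection (startVertex P) f (firstEdge P) → f ∈ᵛ edges P
      maxAtEnd   : ∀ f → f ∈ F → SameDirection (endVertex P) f (lastEdge P) → f ∈ᵛ edges P

-- The current values of 𝒟 (in order of insertion) and ℱ.
Config : ℕ → ℕ → Set
Config n m = List (Path n m) × Subset m

initial : ∀ {n m} → Config n m
initial = [] , ⊤

module _ {n m : ℕ} {G : Graph n m} (μ : Orientation G) where

  -- One iteration of the while loop.  The choice of the maximal AD path is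
  -- left open, so the procedure is nondeterministic.
  data Iteration : Config n m → Config n m → Set where
    iterate : ∀ {D F P} → Nonempty F → IsMaximalADPath μ F P →
              Iteration (D , F) (D ∷ʳ P , F ─ edgeSet P)

  Reachable : Config n m → Set
  Reachable = Star Iteration initial

  Returns : List (Path n m) → Set
  Returns D = ∃ λ F → Reachable (D , F) × Empty F

PartitionsEdges : ∀ {n m} → List (Path n m) → Set
PartitionsEdges {n} {m} D = ∀ (e : Fin m) → ∃! _≡_ λ i → e ∈ᵛ edges (lookup D i)

AtMostOne : ∀ {A : Set} → (A → Set) → List A → Set
AtMostOne Q xs = ∀ i j → Q (lookup xs i) → Q (lookup xs j) → i ≡ j

-- Running time is measured for programs of a random access machine with
-- registers and arrays of natural numbers; a program mentions only finitely
-- many of each.  Every operation, memory access and test takes one unit of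
-- time.  The only arithmetic is successor and predecessor, so t steps
-- increase the largest stored number by at most t beyond the input and the
-- literals of the program, and unit cost hides no long-number arithmetic.

record Store : Set where
  constructor store
  field
    reg : ℕ → ℕ
    arr : ℕ → ℕ → ℕ

open Store public

update : ∀ {A : Set} → (ℕ → A) → ℕ → A → ℕ → A
update f k x i = if i ≡ᵇ k then x else f i

data Expr : Set where
  lit : ℕ → Expr
  var : ℕ → Expr
  at  : ℕ → Expr → Expr
  inc : Expr → Expr
  dec : Expr → Expr

eval : Expr → Store → ℕ
eval (lit k)  s = k
eval (var x)  s = reg s x
eval (at a e) s = arr s a (eval e s)
eval (inc e)  s = suc (eval e s)
eval (dec e)  s = pred (eval e s)

costᵉ : Expr → ℕ
costᵉ (lit k)  = 1
costᵉ (var x)  = 1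
costᵉ (at a e) = suc (costᵉ e)
costᵉ (inc e)  = suc (costᵉ e)
costᵉ (dec e)  = suc (costᵉ e)

data Test : Set where
  _==_ _<<_ : Expr → Expr → Test

holds : Test → Store → Bool
holds (e == f) s = eval e s ≡ᵇ eval f s
holds (e << f) s = eval e s <ᵇ eval f s

costᵗ : Test → ℕ
costᵗ (e == f) = suc (costᵉ e + costᵉ f)
costᵗ (e << f) = suc (costᵉ e + costᵉ f)

infixr 3 _⨾_

data Program : Set where
  skip  : Program
  set   : (x : ℕ) → Expr → Program
  write : (a : ℕ) → (index value : Expr) → Program
  _⨾_   : Program → Program → Program
  cond  : Test → Program → Program → Program
  while : Test → Program → Program

-- Exec p s s′ t: started in s, the program p halts in s′ after t time units.
data Exec : Program → Store → Store → ℕ → Set where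
  exec-skip  : ∀ {s} → Exec skip s s 1
  exec-set   : ∀ {s x e} →
               Exec (set x e) s (store (update (reg s) x (eval e s)) (arr s)) (suc (costᵉ e))
  exec-write : ∀ {s a e f} →
               Exec (write a e f) s
                    (store (reg s) (update (arr s) a (update (arr s a) (eval e s) (eval f s))))
                    (suc (costᵉ e + costᵉ f))
  exec-seq   : ∀ {p q s s′ s″ t u} → Exec p s s′ t → Exec q s′ s″ u → Exec (p ⨾ q) s s″ (t + u)
  exec-true  : ∀ {b p q s s′ t} → holds b s ≡ true → Exec p s s′ t →
               Exec (cond b p q) s s′ (costᵗ b + t)
  exec-false : ∀ {b p q s s′ t} → holds b s ≡ false → Exec q s s′ t →
               Exec (cond b p q) s s′ (costᵗ b + t)
  exec-loop  : ∀ {b p s s′ s″ t u} → holds b s ≡ true → Exec p s s′ t → Exec (while b p) s′ s″ u →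
               Exec (while b p) s s″ (costᵗ b + (t + u))
  exec-exit  : ∀ {b p s} → holds b s ≡ false → Exec (while b p) s s (costᵗ b)

padded : List ℕ → ℕ → ℕ
padded []       _       = 0
padded (x ∷ xs) zero    = x
padded (x ∷ xs) (suc i) = padded xs i

-- The oriented graph is given as a bare list of arcs: registers 0 and 1 hold
-- n and m, arrays 0 and 1 hold the tail and the head of each edge, and all
-- other memory cells are 0.
input : ∀ {n m} {G : Graph n m} → Orientation G → Store
input {n} {m} μ = store (padded (n ∷ m ∷ [])) arrays
  where
  arrays : ℕ → ℕ → ℕ
  arrays 0 = padded (tabulate (toℕ ∘ Orientation.tail μ))
  arrays 1 = padded (tabulate (toℕ ∘ Orientation.head μ))
  arrays _ = λ _ → 0

interleave : ∀ {k} → Vec ℕ (suc k) → Vec ℕ k → List ℕ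
interleave (v ∷ [])      []       = v ∷ []
interleave (v ∷ w ∷ vs)  (e ∷ es) = v ∷ e ∷ interleave (w ∷ vs) es

-- k, v₀, e₁, v₁, …, e_k, v_k
serialise : ∀ {n m} → Path n m → List ℕ
serialise P = suc (ℓ P) ∷ interleave (Vec.map toℕ (vertices P)) (Vec.map toℕ (edges P))

-- Register 0 holds the number of paths, and array 2 starts with the paths
-- one after the other.
Outputs : ∀ {n m} → Store → List (Path n m) → Set
Outputs s D = reg s 0 ≡ length D × applyUpTo (arr s 2) (length w) ≡ w
  where w = concatMap serialise D

{-# OPTIONS --safe #-}
module Submission where

-- Split every vertex into a tail half and a head half; an alternating-directions
-- path is then a trail in the bipartite graph whose edges join the tail half of
-- one end to the head half of the other. A maximal path ending at a half uses up
-- all remaining edges there, so no later path ends at that half.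
--
-- For the time bound, each half keeps a linked list of its edges. A path is
-- found by walking from an unused edge until stuck, stacking the edges;
-- unstacking them reverses the walk, which is then extended at its other end.
-- All of this is one loop with a loop-free body, and
-- 4 · #unused edges + #edges not yet scanned + #list cells + #stacked edges + mode credit
-- drops in every iteration.

open import Defs
open import Data.Bool.Base using (true; false; if_then_else_; T)
open import Data.Empty using (⊥)
open import Data.Fin.Base using (Fin; toℕ; fromℕ<; inject₁; fromℕ) renaming (zero to fzero; suc to fsuc)
open import Data.Fin.Properties using (any?; _≟_; toℕ-injective; toℕ-fromℕ<; toℕ<n) renaming (suc-injective to fsuc-injective)
open import Data.Fin.Subset using (Subset; _∈_; _∉_; _⊆_; _─_; _-_; ⋃; ⁅_⁆; ⊤; ∣_∣; Nonempty; Empty; inside; outside)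
open import Data.Fin.Subset.Properties using (_∈?_; ∈⊤; ∉⊥; ∣⊤∣≡n; x∈⁅x⁆; x∈⁅y⁆⇒x≡y; x∈p∪q⁺; x∈p∪q⁻; x∈p∩q⁺; p─q⊆p; x∈p∧x∉q⇒x∈p─q; x∈p∧x≢y⇒x∈p-y; x∈p⇒∣p-x∣<∣p∣; p∩q≢∅⇒∣p─q∣<∣p∣)
open import Data.List.Base using (List; []; _∷_; _∷ʳ_; _++_; length; lookup; tabulate; applyUpTo; concatMap)
open import Data.List.Membership.Propositional using () renaming (_∈_ to _∈ˡ_)
open import Data.List.Membership.Propositional.Properties using (∈-++⁺ˡ; ∈-++⁺ʳ) renaming (∈-lookup to ∈ˡ-lookup)
open import Data.List.Properties using (++-assoc; ++-identityʳ; concatMap-++; length-++)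
open import Data.List.Relation.Unary.All as All using (All; []; _∷_)
open import Data.List.Relation.Unary.All.Properties as All using ()
open import Data.List.Relation.Unary.AllPairs using (AllPairs; []; _∷_)
open import Data.List.Relation.Unary.AllPairs.Properties as AllPairs using ()
open import Data.List.Relation.Unary.Any as Any using (Any; here; there)
open import Data.List.Relation.Unary.Any.Properties as Any using (lookup-index)
open import Data.List.Relation.Unary.Unique.Propositional using (Unique)
open import Data.Nat.Base
open import Data.Nat.Induction using (<-wellFounded)
open import Data.Nat.Properties hiding (_≟_)
open import Data.Nat.Solver using (module +-*-Solver)
open import Data.Product using (_×_; _,_; ∃; ∃-syntax; proj₁; proj₂)
open import Data.Sum.Base using (_⊎_; inj₁; inj₂; [_,_]′)
open import Data.Unit.Base using (tt) renaming (⊤ to Unit)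
open import Data.Vec.Base as Vec using (Vec; []; _∷_)
open import Data.Vec.Membership.Propositional using () renaming (_∈_ to _∈ᵛ_)
open import Data.Vec.Membership.Propositional.Properties using (∈-fromList⁺; ∈-fromList⁻) renaming (∈-lookup to ∈ᵛ-lookup)
open import Data.Vec.Relation.Unary.All as Allᵛ using ([]; _∷_)
open import Data.Vec.Relation.Unary.All.Properties as Allᵛ using ()
open import Data.Vec.Relation.Unary.AllPairs using ([]; _∷_)
open import Data.Vec.Relation.Unary.Any using (here; there) renaming (any? to anyᵛ?)
open import Data.Vec.Relation.Unary.Unique.Propositional using () renaming (Unique to Uniqueᵛ)
open import Function.Base using (_∘_; id; flip; _on_)
open import Induction.WellFounded using (Acc; acc)
open import Relation.Binary.Construct.Closure.ReflexiveTransitive using (Star; ε; _◅_; _◅◅_)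
open import Relation.Binary.Construct.On using () renaming (wellFounded to on-wellFounded)
open import Relation.Binary.PropositionalEquality using (_≡_; _≢_; refl; sym; trans; cong; cong₂; subst; module ≡-Reasoning)
open import Relation.Nullary using (¬_; Dec; yes; no; contradiction)
open import Relation.Nullary.Decidable using (_×-dec_)

-- The combinatorial claims concern every run of a nondeterministic procedure, whereas the program
-- realises one run. The link is a `Reachable` derivation kept in the loop invariant, which grows by
-- one `Iteration` only when a path is complete. Meanwhile the program consumes edges one at a time,
-- so the invariant carries two edge sets: `F`, the value in the procedure, and `free`, what the
-- program has left. Every edge has a cell in the list of each of its two halves, but is taken
-- through at most one of them. Deletion is therefore lazy: a cell of a used edge stays until a scan
-- meets and discards it. The lists then satisfy a one-sided property only (every free edge is
-- present), and this suffices, because an empty list still certifies that no free edge is left at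
-- the half. A single scan or walk has no constant bound of its own, so its cost must be amortised;
-- in one flat loop this amounts to one decreasing number.

-- Subsets, edge sets of paths, and uniqueness by position

∈─⇒∉ : ∀ {n} {x : Fin n} (p q : Subset n) → x ∈ p ─ q → x ∉ q
∈─⇒∉ (inside  ∷ p) (inside  ∷ q) ()             Vec.here
∈─⇒∉ (outside ∷ p) (inside  ∷ q) ()             Vec.here
∈─⇒∉ (_ ∷ p)       (inside  ∷ q) (Vec.there x∈) (Vec.there x∈q) = ∈─⇒∉ p q x∈ x∈q
∈─⇒∉ (_ ∷ p)       (outside ∷ q) (Vec.there x∈) (Vec.there x∈q) = ∈─⇒∉ p q x∈ x∈q

∈-⋃⁅⁆⁺ : ∀ {m k} {e : Fin m} {es : Vec (Fin m) k} → e ∈ᵛ es → e ∈ ⋃ (Vec.toList (Vec.map ⁅_⁆ es))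
∈-⋃⁅⁆⁺ (here refl) = x∈p∪q⁺ (inj₁ (x∈⁅x⁆ _))
∈-⋃⁅⁆⁺ (there e∈)  = x∈p∪q⁺ (inj₂ (∈-⋃⁅⁆⁺ e∈))

∈-⋃⁅⁆⁻ : ∀ {m k} {e : Fin m} (es : Vec (Fin m) k) → e ∈ ⋃ (Vec.toList (Vec.map ⁅_⁆ es)) → e ∈ᵛ es
∈-⋃⁅⁆⁻ []       e∈ = contradiction e∈ ∉⊥
∈-⋃⁅⁆⁻ (f ∷ es) e∈ = [ here ∘ x∈⁅y⁆⇒x≡y f , there ∘ ∈-⋃⁅⁆⁻ es ]′ (x∈p∪q⁻ ⁅ f ⁆ _ e∈)

Unique-fromList : ∀ {A : Set} {xs : List A} → Unique xs → Uniqueᵛ (Vec.fromList xs)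
Unique-fromList []        = []
Unique-fromList (x∉ ∷ u) = Allᵛ.fromList⁺ x∉ ∷ Unique-fromList u

-- `AllPairs` compares an earlier entry with a later one only; mutual exclusion is symmetric, so
-- this is enough and it fits a list that grows at its end.
AllPairs⇒AtMostOne : ∀ {A : Set} {Q : A → Set} {xs : List A} →
                     AllPairs (λ x y → Q x → ¬ Q y) xs → AtMostOne Q xs
AllPairs⇒AtMostOne (r ∷ rs) fzero    fzero    _  _  = refl
AllPairs⇒AtMostOne {xs = _ ∷ xs} (r ∷ rs) fzero    (fsuc j) qi qj = contradiction qj (All.lookup r (∈ˡ-lookup {xs = xs} j) qi)
AllPairs⇒AtMostOne {xs = _ ∷ xs} (r ∷ rs) (fsuc i) fzero    qi qj = contradiction qi (All.lookup r (∈ˡ-lookup {xs = xs} i) qj)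
AllPairs⇒AtMostOne (r ∷ rs) (fsuc i) (fsuc j) qi qj = cong fsuc (AllPairs⇒AtMostOne rs i j qi qj)

-- tl is the half of a vertex carrying the arcs that leave it, hd the half
-- carrying the arcs that enter it.
data Side : Set where
  tl hd : Side

opp : Side → Side
opp tl = hd
opp hd = tl

-- Bookkeeping for a growing trail

module _ {m : ℕ} where

  -- F is the edge set when the current trail was begun, T the edges of that
  -- trail, and free the edges of F not yet on it.
  record Trail (F free : Subset m) (T : List (Fin m)) : Set where
    field
      distinct : Unique T
      inF      : All (_∈ F) T
      spent    : All (_∉ free) T
      free⊆F   : free ⊆ F
      cover    : ∀ {f} → f ∈ F → f ∈ free ⊎ f ∈ˡ T

  trail-[] : ∀ {F} → Trail F F []
  trail-[] = record { distinct = [] ; inF = [] ; spent = [] ; free⊆F = λ f∈ → f∈ ; cover = inj₁ }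

  ∉-remove : ∀ {free : Subset m} (e : Fin m) {f} → f ∉ free → f ∉ free - e
  ∉-remove {free} e f∉ f∈ = f∉ (p─q⊆p free ⁅ e ⁆ f∈)

  ∉-removed : ∀ {e} (free : Subset m) → e ∉ free - e
  ∉-removed {e} free e∈ = ∈─⇒∉ free ⁅ e ⁆ e∈ (x∈⁅x⁆ e)

  cover-take : ∀ {F free T} (e : Fin m) → (∀ {f} → f ∈ F → f ∈ free ⊎ f ∈ˡ T) →
               ∀ {f} → f ∈ F → f ∈ free - e ⊎ (f ≡ e ⊎ f ∈ˡ T)
  cover-take e cover {f} f∈ with cover f∈ | f ≟ e
  ... | inj₂ f∈T    | _        = inj₂ (inj₂ f∈T)
  ... | inj₁ _      | yes f≡e  = inj₂ (inj₁ f≡e)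
  ... | inj₁ f∈free | no f≢e   = inj₁ (x∈p∧x≢y⇒x∈p-y f∈free f≢e)

  trail-cons : ∀ {F free T e} → Trail F free T → e ∈ free → Trail F (free - e) (e ∷ T)
  trail-cons {F} {free} {T} {e} t e∈ = record
    { distinct = All.map (λ { f∉ refl → f∉ e∈ }) spent ∷ distinct
    ; inF      = free⊆F e∈ ∷ inF
    ; spent    = ∉-removed free ∷ All.map (∉-remove e) spent
    ; free⊆F   = free⊆F ∘ p─q⊆p free ⁅ e ⁆
    ; cover    = λ f∈ → [ inj₁ , inj₂ ∘ [ here , there ]′ ]′ (cover-take e cover f∈)
    } where open Trail t

  trail-snoc : ∀ {F free T e} → Trail F free T → e ∈ free → Trail F (free - e) (T ∷ʳ e)
  trail-snoc {F} {free} {T} {e} t e∈ = record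
    { distinct = AllPairs.++⁺ distinct ([] ∷ []) (All.map (λ { f∉ → (λ { refl → f∉ e∈ }) ∷ [] }) spent)
    ; inF      = All.∷ʳ⁺ inF (free⊆F e∈)
    ; spent    = All.∷ʳ⁺ (All.map (∉-remove e) spent) (∉-removed free)
    ; free⊆F   = free⊆F ∘ p─q⊆p free ⁅ e ⁆
    ; cover    = λ f∈ → [ inj₁ , inj₂ ∘ [ (λ f≡e → ∈-++⁺ʳ T (here f≡e)) , ∈-++⁺ˡ ]′ ]′ (cover-take e cover f∈)
    } where open Trail t

  ∈─edgeSet⁺ : ∀ {n} {F} (P : Path n m) {e} → e ∈ F → ¬ e ∈ᵛ edges P → e ∈ F ─ edgeSet P
  ∈─edgeSet⁺ P e∈ e∉ = x∈p∧x∉q⇒x∈p─q e∈ (e∉ ∘ ∈-⋃⁅⁆⁻ (edges P))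

  ∈─edgeSet⁻ : ∀ {n} {F} (P : Path n m) {e} → e ∈ F ─ edgeSet P → e ∈ F × ¬ e ∈ᵛ edges P
  ∈─edgeSet⁻ {F = F} P e∈ = p─q⊆p F (edgeSet P) e∈ , ∈─⇒∉ F (edgeSet P) e∈ ∘ ∈-⋃⁅⁆⁺

  ∣∣-wellFounded : ∀ (p : Subset m) → Acc (_<_ on ∣_∣) p
  ∣∣-wellFounded = on-wellFounded ∣_∣ <-wellFounded

-- Walks between halves and the existence of maximal AD paths

module _ {n m : ℕ} {G : Graph n m} (μ : Orientation G) where
  open Orientation μ

  end : Side → Fin m → Fin n
  end tl = tail
  end hd = head

  joins-end : ∀ d e → Joins G e (end d e) (end (opp d) e)
  joins-end tl e = joins e
  joins-end hd e = [ inj₂ , inj₁ ]′ (joins e)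

  tail≢head : ∀ e → tail e ≢ head e
  tail≢head e eq with joins e
  ... | inj₁ j = Graph.loopless G e _ _ j eq
  ... | inj₂ j = Graph.loopless G e _ _ j (sym eq)

  incident : ∀ {e u v} → Joins G e u v → tail e ≡ u ⊎ head e ≡ u
  incident {e} j with joins e
  incident (inj₁ a) | inj₁ b with trans (sym a) b
  ... | refl = inj₁ refl
  incident (inj₁ a) | inj₂ b with trans (sym a) b
  ... | refl = inj₂ refl
  incident (inj₂ a) | inj₁ b with trans (sym a) b
  ... | refl = inj₂ refl
  incident (inj₂ a) | inj₂ b with trans (sym a) b
  ... | refl = inj₁ refl

  sameDirection⁺ : ∀ d {v e f} → end d e ≡ v → end d f ≡ v → SameDirection μ v e f
  sameDirection⁺ tl p q = inj₂ (p , q)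
  sameDirection⁺ hd p q = inj₁ (p , q)

  -- Looplessness enters here: agreement on the side opposite to `d` would put both ends of `e` at
  -- `v`.
  sameDirection⁻ : ∀ d {v e f} → end d e ≡ v → SameDirection μ v f e → end d f ≡ v
  sameDirection⁻ tl p (inj₁ (_ , q)) = contradiction (trans p (sym q)) (tail≢head _)
  sameDirection⁻ tl p (inj₂ (q , _)) = q
  sameDirection⁻ hd p (inj₁ (q , _)) = q
  sameDirection⁻ hd p (inj₂ (_ , q)) = contradiction (trans q (sym p)) (tail≢head _)

  -- A walk from the half `(d , v)` to the half `(d′ , v′)`. Each edge leaves a vertex from the very
  -- half at which the previous edge arrived, so the alternation of directions is built in.
  data Walk : Side → Fin n → List (Fin m) → Side → Fin n → Set where
    []  : ∀ {d v} → Walk d v [] d v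
    _∷_ : ∀ {d v e es d′ v′} → end d e ≡ v → Walk (opp d) (end (opp d) e) es d′ v′ →
          Walk d v (e ∷ es) d′ v′

  -- Traverses `e` against the direction in which it was reached. The split on `d` makes
  -- `opp (opp d)` compute.
  walk-back : ∀ d {v e es d′ v′} → end d e ≡ v → Walk d v es d′ v′ →
              Walk (opp d) (end (opp d) e) (e ∷ es) d′ v′
  walk-back tl refl w = refl ∷ w
  walk-back hd refl w = refl ∷ w

  walk-snoc : ∀ {d v es d′ v′ e} → Walk d v es d′ v′ → end d′ e ≡ v′ →
              Walk d v (es ∷ʳ e) (opp d′) (end (opp d′) e)
  walk-snoc []      q = q ∷ []
  walk-snoc (p ∷ w) q = p ∷ walk-snoc w q

  visited : Side → (es : List (Fin m)) → Vec (Fin n) (length es)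
  visited d []       = []
  visited d (e ∷ es) = end (opp d) e ∷ visited (opp d) es

  toPath : Side → Fin n → Fin m → List (Fin m) → Path n m
  toPath d v e es = record
    { ℓ        = length es
    ; vertices = v ∷ visited d (e ∷ es)
    ; edges    = Vec.fromList (e ∷ es)
    }

  joins-walk : ∀ {d v es d′ v′} → Walk d v es d′ v′ → ∀ i →
               Joins G (Vec.lookup (Vec.fromList es) i)
                       (Vec.lookup (v ∷ visited d es) (inject₁ i)) (Vec.lookup (visited d es) i)
  joins-walk {d} (refl ∷ w) fzero    = joins-end d _
  joins-walk     (p ∷ w)    (fsuc i) = joins-walk w i

  alternating-walk : ∀ {d v e es d′ v′} → Walk d v (e ∷ es) d′ v′ → ∀ i →
                     SameDirection μ (Vec.lookup (visited d (e ∷ es)) (inject₁ i))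
                                     (Vec.lookup (Vec.fromList (e ∷ es)) (inject₁ i))
                                     (Vec.lookup (Vec.fromList es) i)
  alternating-walk {d} (_ ∷ q ∷ w) fzero    = sameDirection⁺ (opp d) refl q
  alternating-walk     (_ ∷ q ∷ w) (fsuc i) = alternating-walk (q ∷ w) i

  end-vertex : ∀ {d v es d′ v′} → Walk d v es d′ v′ →
               Vec.lookup (v ∷ visited d es) (fromℕ (length es)) ≡ v′
  end-vertex []      = refl
  end-vertex (p ∷ w) = end-vertex w

  last-edge : ∀ {d v e es d′ v′} → Walk d v (e ∷ es) d′ v′ →
              end d′ (Vec.lookup (Vec.fromList (e ∷ es)) (fromℕ (length es))) ≡ v′
  last-edge {tl} (_ ∷ [])    = refl
  last-edge {hd} (_ ∷ [])    = refl
  last-edge      (_ ∷ q ∷ w) = last-edge (q ∷ w)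

  -- Maximality at one end, in terms of halves. It refers to the fixed `F` rather than to the
  -- shrinking `free`, so it survives any further growth of `T`.
  Exhausted : Subset m → Side → Fin n → List (Fin m) → Set
  Exhausted F d v T = ∀ {f} → f ∈ F → end d f ≡ v → f ∈ˡ T

  exhausted : ∀ {F free T} d v → Trail F free T → (∀ {f} → f ∈ free → end d f ≢ v) → Exhausted F d v T
  exhausted d v t none f∈ p = [ (λ f∈free → contradiction p (none f∈free)) , (λ f∈T → f∈T) ]′ (Trail.cover t f∈)

  toPath-maximal : ∀ {F free d v e es d′ v′} → Walk d v (e ∷ es) d′ v′ → Trail F free (e ∷ es) →
                   Exhausted F d v (e ∷ es) → Exhausted F d′ v′ (e ∷ es) →
                   IsMaximalADPath μ F (toPath d v e es)
  toPath-maximal {d = d} {d′ = d′} {v′ = v′} w@(p ∷ _) t start stop = record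
    { isADPath   = record
      { walk        = joins-walk w
      ; distinct    = Unique-fromList (Trail.distinct t)
      ; alternating = alternating-walk w
      }
    ; inF        = Allᵛ.fromList⁺ (Trail.inF t)
    ; maxAtStart = λ f f∈ same → ∈-fromList⁺ (start f∈ (sameDirection⁻ d p same))
    ; maxAtEnd   = λ f f∈ same → ∈-fromList⁺ (stop f∈ (sameDirection⁻ d′ (last-edge w)
                     (subst (λ v → SameDirection μ v _ _) (end-vertex w) same)))
    }

  free-at? : ∀ (free : Subset m) d v → Dec (∃[ f ] (f ∈ free × end d f ≡ v))
  free-at? free d v = any? λ f → (f ∈? free) ×-dec (end d f ≟ v)

  extend-end : ∀ {F} free → Acc (_<_ on ∣_∣) free → ∀ {d v e es d′ v′} →
               Walk d v (e ∷ es) d′ v′ → Trail F free (e ∷ es) → Exhausted F d v (e ∷ es) →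
               ∃ (IsMaximalADPath μ F)
  extend-end free (acc rs) {es = es} {d′} {v′} w t start with free-at? free d′ v′
  ... | no none = _ , toPath-maximal w t start (exhausted d′ v′ t (λ f∈ p → none (_ , f∈ , p)))
  ... | yes (f , f∈ , p) = extend-end (free - f) (rs (x∈p⇒∣p-x∣<∣p∣ f∈)) (walk-snoc w p) (trail-snoc t f∈)
                             (λ g∈ q → ∈-++⁺ˡ (start g∈ q))

  -- Each extension removes an edge from `free`. Exhaustion of the start cannot be undone while the
  -- other end is extended, so one pass at each end is enough, even if both ends lie at the same
  -- half.
  extend-start : ∀ {F} free → Acc (_<_ on ∣_∣) free → ∀ {d v e es d′ v′} →
                 Walk d v (e ∷ es) d′ v′ → Trail F free (e ∷ es) →
                 ∃ (IsMaximalADPath μ F)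
  extend-start free (acc rs) {d} {v} w t with free-at? free d v
  ... | no none = extend-end free (acc rs) w t (exhausted d v t (λ f∈ p → none (_ , f∈ , p)))
  ... | yes (f , f∈ , p) = extend-start (free - f) (rs (x∈p⇒∣p-x∣<∣p∣ f∈)) (walk-back d p w) (trail-cons t f∈)

  maximal-exists : ∀ {F} → Nonempty F → ∃ (IsMaximalADPath μ F)
  maximal-exists {F} (e , e∈) =
    extend-start (F - e) (∣∣-wellFounded _) {tl} {tail e} (refl ∷ []) (trail-cons trail-[] e∈)

  ∈edges⇒∈F : ∀ {F P e} → IsMaximalADPath μ F P → e ∈ᵛ edges P → e ∈ F
  ∈edges⇒∈F max e∈ = Allᵛ.lookup (IsMaximalADPath.inF max) e∈

  -- Termination, partition and endpoint bounds for all runs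

  iteration-decreases : ∀ {c c′} → Iteration μ c c′ → ∣ proj₂ c′ ∣ < ∣ proj₂ c ∣
  iteration-decreases (iterate {F = F} {P} _ max) =
    p∩q≢∅⇒∣p─q∣<∣p∣ F (edgeSet P)
      (firstEdge P , x∈p∩q⁺ (∈edges⇒∈F max first∈ , ∈-⋃⁅⁆⁺ first∈))
    where first∈ = ∈ᵛ-lookup fzero (edges P)

  terminates : ∀ c → Acc (flip (Iteration μ)) c
  terminates c = go c (<-wellFounded _)
    where
    go : ∀ c → Acc _<_ ∣ proj₂ c ∣ → Acc (flip (Iteration μ)) c
    go c (acc rs) = acc λ it → go _ (rs (iteration-decreases it))

  invariant : (I : Config n m → Set) → (∀ {c c′} → Iteration μ c c′ → I c → I c′) →
              I initial → ∀ {c} → Reachable μ c → I c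
  invariant I step i r = go i r
    where
    go : ∀ {c c′} → I c → Star (Iteration μ) c c′ → I c′
    go i ε        = i
    go i (x ◅ xs) = go (step x i) xs

  covers : ∀ {D F} → Reachable μ (D , F) → ∀ e → e ∈ F ⊎ Any (λ P → e ∈ᵛ edges P) D
  covers r e = invariant (λ { (D , F) → e ∈ F ⊎ Any (λ P → e ∈ᵛ edges P) D }) step (inj₁ ∈⊤) r
    where
    step : ∀ {c c′} → Iteration μ c c′ →
           e ∈ proj₂ c ⊎ Any (λ P → e ∈ᵛ edges P) (proj₁ c) →
           e ∈ proj₂ c′ ⊎ Any (λ P → e ∈ᵛ edges P) (proj₁ c′)
    step (iterate {D = D} _ _)         (inj₂ e∈) = inj₂ (Any.++⁺ˡ e∈)
    step (iterate {D = D} {F} {P} _ _) (inj₁ e∈) with anyᵛ? (e ≟_) (edges P)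
    ... | yes e∈P = inj₂ (Any.++⁺ʳ D (here e∈P))
    ... | no  e∉P = inj₁ (∈─edgeSet⁺ P e∈ e∉P)

  all-ad : ∀ {D F} → Reachable μ (D , F) → All (IsADPath μ) D
  all-ad = invariant (All (IsADPath μ) ∘ proj₁)
    (λ { (iterate _ max) ps → All.∷ʳ⁺ ps (IsMaximalADPath.isADPath max) }) []

  -- A path with `Q` needs an edge with `R` and also removes all such edges from `F`, so none is
  -- left for a later path with `Q`. With `R` meaning "is `e`", "has head `v`" or "has tail `v`",
  -- this gives disjointness and the two endpoint bounds. The second half of the invariant `I` is
  -- what rules out the next path.
  at-most-one : (Q : Path n m → Set) (R : Fin m → Set) →
                (∀ {F P} → IsMaximalADPath μ F P → Q P → ∃[ f ] (f ∈ F × R f)) →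
                (∀ {F P} → IsMaximalADPath μ F P → Q P → ∀ {f} → f ∈ F → R f → f ∈ᵛ edges P) →
                ∀ {D F} → Reachable μ (D , F) → AtMostOne Q D
  at-most-one Q R uses usesAll r = AllPairs⇒AtMostOne (proj₁ (invariant I step ([] , []) r))
    where
    I : Config n m → Set
    I (D , F) = AllPairs (λ P P′ → Q P → ¬ Q P′) D × All (λ P → Q P → ∀ f → f ∈ F → ¬ R f) D
    step : ∀ {c c′} → Iteration μ c c′ → I c → I c′
    step (iterate {F = F} {P} _ max) (pairs , closed) =
      AllPairs.++⁺ pairs ([] ∷ [])
        (All.map (λ cl → (λ q q′ → let f , f∈ , rf = uses max q′ in cl q f f∈ rf) ∷ []) closed) ,
      All.∷ʳ⁺ (All.map (λ cl q f f∈ → cl q f (proj₁ (∈─edgeSet⁻ P f∈))) closed)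
              (λ q f f∈ rf → proj₂ (∈─edgeSet⁻ P f∈) (usesAll max q (proj₁ (∈─edgeSet⁻ P f∈)) rf))

  partitions : ∀ {D F} → Reachable μ (D , F) → Empty F → PartitionsEdges D
  partitions r empty e with covers r e
  ... | inj₁ e∈ = contradiction (e , e∈) empty
  ... | inj₂ e∈ = Any.index e∈ , lookup-index e∈ , λ {j} → once (Any.index e∈) j (lookup-index e∈)
    where
    once = at-most-one (λ P → e ∈ᵛ edges P) (_≡ e)
             (λ max e∈P → e , ∈edges⇒∈F max e∈P , refl)
             (λ { max e∈P _ refl → e∈P }) r

  module _ {F : Subset m} {P : Path n m} (max : IsMaximalADPath μ F P) where
    open IsMaximalADPath max
    open IsADPath isADPath

    endpoint-edges : ∀ d {v} → (v ≡ startVertex P × end d (firstEdge P) ≡ v)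
                             ⊎ (v ≡ endVertex P × end d (lastEdge P) ≡ v) →
                     ∃[ f ] (f ∈ F × end d f ≡ v)
    endpoint-edges d (inj₁ (_ , p)) = _ , ∈edges⇒∈F max (∈ᵛ-lookup fzero (edges P)) , p
    endpoint-edges d (inj₂ (_ , p)) = _ , ∈edges⇒∈F max (∈ᵛ-lookup (fromℕ (ℓ P)) (edges P)) , p

    endpoint-exhausts : ∀ d {v} → (v ≡ startVertex P × end d (firstEdge P) ≡ v)
                                ⊎ (v ≡ endVertex P × end d (lastEdge P) ≡ v) →
                        ∀ {f} → f ∈ F → end d f ≡ v → f ∈ᵛ edges P
    endpoint-exhausts d (inj₁ (refl , p)) f∈ q = maxAtStart _ f∈ (sameDirection⁺ d q p)
    endpoint-exhausts d (inj₂ (refl , p)) f∈ q = maxAtEnd _ f∈ (sameDirection⁺ d q p)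

    -- An outgoing endpoint is defined by a negation; since the edge is incident to `v`, not having
    -- its head there forces its tail there.
    outgoing-away : ∀ {v} → OutgoingEndpoint μ v P → (v ≡ startVertex P × Away μ (firstEdge P) v)
                                                   ⊎ (v ≡ endVertex P × Away μ (lastEdge P) v)
    outgoing-away (inj₁ (refl , ¬to)) =
      inj₁ (refl , [ (λ p → p) , (λ p → contradiction p ¬to) ]′ (incident (walk fzero)))
    outgoing-away (inj₂ (refl , ¬to)) =
      inj₂ (refl , [ (λ p → p) , (λ p → contradiction p ¬to) ]′ (incident ([ inj₂ , inj₁ ]′ (walk (fromℕ (ℓ P))))))

  incoming-once : ∀ {D F} → Reachable μ (D , F) → ∀ v → AtMostOne (IncomingEndpoint μ v) D
  incoming-once r v = at-most-one _ (λ f → head f ≡ v)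
    (λ max → endpoint-edges max hd) (λ max → endpoint-exhausts max hd) r

  outgoing-once : ∀ {D F} → Reachable μ (D , F) → ∀ v → AtMostOne (OutgoingEndpoint μ v) D
  outgoing-once r v = at-most-one _ (λ f → tail f ≡ v)
    (λ max o → endpoint-edges max tl (outgoing-away max o))
    (λ max o → endpoint-exhausts max tl (outgoing-away max o)) r

-- Running time of loop-free programs and of a loop around one

LoopFree : Program → Set
LoopFree (p ⨾ q)      = LoopFree p × LoopFree q
LoopFree (cond _ p q) = LoopFree p × LoopFree q
LoopFree (while _ _)  = ⊥
LoopFree _            = Unit

-- On while loops the value is junk; it is only used for loop-free programs.
run : Program → Store → Store
run skip          s = s
run (set x e)     s = store (update (reg s) x (eval e s)) (arr s)
run (write a e f) s = store (reg s) (update (arr s) a (update (arr s a) (eval e s) (eval f s)))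
run (p ⨾ q)       s = run q (run p s)
run (cond b p q)  s = if holds b s then run p s else run q s
run (while _ _)   s = s

maxTime : Program → ℕ
maxTime skip          = 1
maxTime (set x e)     = suc (costᵉ e)
maxTime (write a e f) = suc (costᵉ e + costᵉ f)
maxTime (p ⨾ q)       = maxTime p + maxTime q
maxTime (cond b p q)  = costᵗ b + (maxTime p ⊔ maxTime q)
maxTime (while b p)   = 0

exec-run : ∀ p → LoopFree p → ∀ s → ∃[ t ] (Exec p s (run p s) t × t ≤ maxTime p)
exec-run skip          _         s = _ , exec-skip , ≤-refl
exec-run (set x e)     _         s = _ , exec-set , ≤-refl
exec-run (write a e f) _         s = _ , exec-write , ≤-refl
exec-run (p ⨾ q)       (lp , lq) s =
  let _ , x , x≤ = exec-run p lp s
      _ , y , y≤ = exec-run q lq (run p s)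
  in _ , exec-seq x y , +-mono-≤ x≤ y≤
exec-run (cond b p q)  (lp , lq) s with holds b s in eq
... | true  = let _ , x , x≤ = exec-run p lp s in
              _ , exec-true eq x , +-monoʳ-≤ (costᵗ b) (≤-trans x≤ (m≤m⊔n _ _))
... | false = let _ , y , y≤ = exec-run q lq s in
              _ , exec-false eq y , +-monoʳ-≤ (costᵗ b) (≤-trans y≤ (m≤n⊔m _ _))

-- Unlike P (run p s), this does not unfold, so p and s can be inferred from it.
record After (P : Store → Set) (p : Program) (s : Store) : Set where
  constructor after
  field
    result : P (run p s)

open After public

after-true : ∀ {P b p q s} → holds b s ≡ true → After P p s → After P (cond b p q) s
after-true {P} {b} {p} {q} {s} eq (after x) = after (subst (λ h → P (if h then run p s else run q s)) (sym eq) x)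

after-false : ∀ {P b p q s} → holds b s ≡ false → After P q s → After P (cond b p q) s
after-false {P} {b} {p} {q} {s} eq (after x) = after (subst (λ h → P (if h then run p s else run q s)) (sym eq) x)

after-seq : ∀ {P p q s} → After P q (run p s) → After P (p ⨾ q) s
after-seq (after x) = after x

-- `k` rounds of test and body, and the final test that fails.
loopTime : Test → Program → ℕ → ℕ
loopTime b p k = costᵗ b + k * (costᵗ b + maxTime p)

-- The measure is the index of the invariant, so a single induction yields halting, the invariant on
-- exit and the number of rounds. Loop-freeness of the body bounds each round by a constant.
while-rule : ∀ {b p} (I : ℕ → Store → Set) → LoopFree p →
             (∀ {k s} → I k s → holds b s ≡ true → ∃[ k′ ] (k′ < k × I k′ (run p s))) →
             ∀ {k s} → I k s →
             ∃[ s′ ] ∃[ t ] ∃[ k′ ] (Exec (while b p) s s′ t × t ≤ loopTime b p k × I k′ s′ × holds b s′ ≡ false)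
while-rule {b} {p} I free step = go _ (<-wellFounded _)
  where
  go : ∀ k → Acc _<_ k → ∀ {s} → I k s →
       ∃[ s′ ] ∃[ t ] ∃[ k′ ] (Exec (while b p) s s′ t × t ≤ loopTime b p k × I k′ s′ × holds b s′ ≡ false)
  go k (acc rs) {s} i with holds b s in eq
  ... | false = s , _ , k , exec-exit eq , m≤m+n _ _ , i , eq
  ... | true  with step i eq
  ...   | k′ , k′<k , i′ with go k′ (rs k′<k) i′ | exec-run p free s
  ...     | s″ , u , k″ , y , u≤ , i″ , eq″ | t , x , t≤ =
    s″ , _ , k″ , exec-loop eq x y , time , i″ , eq″
    where
    open ≤-Reasoning
    B = costᵗ b + maxTime p
    time : costᵗ b + (t + u) ≤ loopTime b p k
    time = begin
      costᵗ b + (t + u)                          ≤⟨ +-monoʳ-≤ (costᵗ b) (+-mono-≤ t≤ u≤) ⟩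
      costᵗ b + (maxTime p + (costᵗ b + k′ * B)) ≡⟨ cong (costᵗ b +_) (+-comm (maxTime p) _) ⟩
      costᵗ b + (costᵗ b + k′ * B + maxTime p)   ≡⟨ cong (costᵗ b +_)
        (trans (cong (_+ maxTime p) (+-comm (costᵗ b) _)) (+-assoc (k′ * B) _ _)) ⟩
      costᵗ b + (k′ * B + B)                     ≡⟨ cong (costᵗ b +_) (+-comm (k′ * B) B) ⟩
      costᵗ b + suc k′ * B                       ≤⟨ +-monoʳ-≤ (costᵗ b) (*-monoˡ-≤ B k′<k) ⟩
      costᵗ b + k * B                            ∎

-- Lists of numbers, stacks and linked lists in arrays

≡ᵇ-true : ∀ {i j} → i ≡ j → (i ≡ᵇ j) ≡ true
≡ᵇ-true {zero}  refl = refl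
≡ᵇ-true {suc i} refl = ≡ᵇ-true {i} refl

≡ᵇ-false : ∀ {i j} → i ≢ j → (i ≡ᵇ j) ≡ false
≡ᵇ-false {zero}  {zero}  i≢j = contradiction refl i≢j
≡ᵇ-false {zero}  {suc j} i≢j = refl
≡ᵇ-false {suc i} {zero}  i≢j = refl
≡ᵇ-false {suc i} {suc j} i≢j = ≡ᵇ-false (i≢j ∘ cong suc)

<ᵇ-true : ∀ {i j} → (i <ᵇ j) ≡ true → i < j
<ᵇ-true {i} {j} eq = <ᵇ⇒< i j (subst T (sym eq) tt)

<ᵇ-false : ∀ {i j} → (i <ᵇ j) ≡ false → j ≤ i
<ᵇ-false {i} {j} eq = ≮⇒≥ λ i<j → subst T eq (<⇒<ᵇ i<j)

update-same : ∀ {A : Set} (f : ℕ → A) {k i} x → i ≡ k → update f k x i ≡ x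
update-same f x eq rewrite ≡ᵇ-true eq = refl

update-other : ∀ {A : Set} (f : ℕ → A) {k i} x → i ≢ k → update f k x i ≡ f i
update-other f x i≢k rewrite ≡ᵇ-false i≢k = refl

Seg : (ℕ → ℕ) → List ℕ → Set
Seg f []       = Unit
Seg f (x ∷ xs) = f 0 ≡ x × Seg (f ∘ suc) xs

-- The induction needs no transport, because `update f (suc j) y ∘ suc` computes to
-- `update (f ∘ suc) j y`.
seg-push : ∀ {f xs j x y} → Seg f xs → j ≡ length xs → y ≡ x → Seg (update f j y) (xs ∷ʳ x)
seg-push {xs = []}     _       refl refl = refl , tt
seg-push {xs = _ ∷ xs} (p , r) refl refl = p , seg-push {xs = xs} r refl refl

seg-replace : ∀ {f} xs {y ys j x z} → Seg f (xs ++ y ∷ ys) → j ≡ length xs → z ≡ x →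
              Seg (update f j z) (xs ++ x ∷ ys)
seg-replace []       (_ , r) refl refl = refl , r
seg-replace (_ ∷ xs) (p , r) refl refl = p , seg-replace xs r refl refl

seg⇒applyUpTo : ∀ {f} xs → Seg f xs → applyUpTo f (length xs) ≡ xs
seg⇒applyUpTo []       _       = refl
seg⇒applyUpTo (x ∷ xs) (p , r) = cong₂ _∷_ p (seg⇒applyUpTo xs r)

padded-tabulate : ∀ {m} (f : Fin m → ℕ) e → padded (tabulate f) (toℕ e) ≡ f e
padded-tabulate f fzero    = refl
padded-tabulate f (fsuc e) = padded-tabulate (f ∘ fsuc) e

module _ {m : ℕ} where

  Stacked : (ℕ → ℕ) → List (Fin m) → Set
  Stacked f []       = Unit
  Stacked f (e ∷ es) = f (length es) ≡ toℕ e × Stacked f es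

  stacked-above : ∀ {f} es {j x} → length es ≤ j → Stacked f es → Stacked (update f j x) es
  stacked-above         []       _   _       = tt
  stacked-above {f} (e ∷ es) len≤j (p , r) =
    trans (update-other f _ (<⇒≢ len≤j)) p , stacked-above es (<⇒≤ len≤j) r

  stacked-push : ∀ {f es j x e} → Stacked f es → j ≡ length es → x ≡ toℕ e → Stacked (update f j x) (e ∷ es)
  stacked-push {f} {es} r refl p = trans (update-same f _ refl) p , stacked-above es ≤-refl r

  -- Pointers are shifted by one, so that 0 is the null pointer.
  Linked : (ℕ → ℕ) → ℕ → List (Fin m) → Set
  Linked next h []       = h ≡ 0
  Linked next h (e ∷ es) = h ≡ suc (toℕ e) × Linked next (next (toℕ e)) es

-- The program

side? : (d d′ : Side) → Dec (d ≡ d′)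
side? tl tl = yes refl
side? tl hd = no λ ()
side? hd tl = no λ ()
side? hd hd = yes refl

pick : ∀ {A : Set} → A → A → Side → A
pick x y tl = x
pick x y hd = y

code : Side → ℕ
code = pick 0 1

rPaths rSize rCursor rMode rSide rSite rEdge rTop rOut rSlot rLen : ℕ
rPaths = 0
rSize = 1
rCursor = 2
rMode = 3
rSide = 4
rSite = 5
rEdge = 6
rTop = 7
rOut = 8
rSlot = 9
rLen = 10

aEnd aFirst aNext : Side → ℕ
aEnd   = pick 0 1
aFirst = pick 3 4
aNext  = pick 5 6

aOut aUsed aStack : ℕ
aOut   = 2
aUsed  = 7
aStack = 8

bump : ℕ → Program
bump x = set x (inc (var x))

emit : Expr → Program
emit e = write aOut (var rOut) e ⨾ bump rOut

link : Side → Program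
link d = write (aNext d) (var rCursor) (at (aFirst d) (at (aEnd d) (var rCursor)))
       ⨾ write (aFirst d) (at (aEnd d) (var rCursor)) (inc (var rCursor))

unlink : Side → Program
unlink d = set rEdge (dec (at (aFirst d) (var rSite)))
         ⨾ write (aFirst d) (var rSite) (at (aNext d) (var rEdge))

push : Program
push = write aUsed (var rEdge) (lit 1) ⨾ write aStack (var rTop) (var rEdge) ⨾ bump rTop

-- One list cell is consumed per call. It is stale if its edge was taken through the other half or
-- was the seed of a path, as `start` marks its edge without unlinking it; `aUsed` tells.
scan : Side → (stuck taken : Program) → Program
scan d stuck taken =
  cond (at (aFirst d) (var rSite) == lit 0)
    stuck
    (unlink d ⨾ cond (at aUsed (var rEdge) == lit 0) (push ⨾ taken) skip)

bySide : (Side → Program) → Program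
bySide p = cond (var rSide == lit 0) (p tl) (p hd)

-- Modes 0, 1, 2 are idle, walking and emitting. The length precedes a path in the output but is
-- known only at its end: `open-record` reserves its cell at `rSlot`, and `close-record` fills it
-- in.
start open-record close-record : Program
start = write aUsed (var rCursor) (lit 1) ⨾ write aStack (lit 0) (var rCursor) ⨾ set rTop (lit 1)
      ⨾ set rSide (lit (code hd)) ⨾ set rSite (at (aEnd hd) (var rCursor)) ⨾ set rMode (lit 1)
open-record = set rSlot (var rOut) ⨾ emit (lit 0) ⨾ emit (var rSite)
            ⨾ set rLen (lit 0) ⨾ set rMode (lit 2)
close-record = write aOut (var rSlot) (var rLen) ⨾ bump rPaths ⨾ set rMode (lit 0)

cross pop : Side → Program
cross d = set rSite (at (aEnd (opp d)) (var rEdge)) ⨾ set rSide (lit (code (opp d)))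
pop d = set rTop (dec (var rTop)) ⨾ set rEdge (at aStack (var rTop)) ⨾ cross d
      ⨾ emit (var rEdge) ⨾ emit (var rSite) ⨾ bump rLen

walkSide emitSide : Side → Program
walkSide d = scan d open-record (cross d)
emitSide d = cond (var rTop == lit 0) (scan d close-record skip) (pop d)

idleStep walkStep emitStep : Program
idleStep = cond (at aUsed (var rCursor) == lit 0) start (bump rCursor)
walkStep = bySide walkSide
emitStep = bySide emitSide

more : Test
more = var rCursor << var rSize

buildBody mainBody : Program
buildBody = link tl ⨾ link hd ⨾ bump rCursor
mainBody = cond (var rMode == lit 0) idleStep (cond (var rMode == lit 1) walkStep emitStep)

-- Register 0 holds the number of vertices on entry and the number of paths on exit, hence the
-- initial reset.
program : Program
program = set rPaths (lit 0) ⨾ while more buildBody ⨾ set rCursor (lit 0) ⨾ while more mainBody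

-- Written output, tables of lists and their total size

Written : (ℕ → ℕ) → ℕ → List ℕ → Set
Written f o xs = Seg f xs × o ≡ length xs

written-push : ∀ {f o xs x y} → Written f o xs → y ≡ x → Written (update f o y) (suc o) (xs ∷ʳ x)
written-push {xs = xs} {x} (seg , len) eq =
  seg-push {xs = xs} seg len eq , trans (cong suc len) (sym (trans (length-++ xs) (+-comm (length xs) 1)))

module _ {A : Set} {n : ℕ} where

  override : (Side → Fin n → A) → Side → Fin n → A → Side → Fin n → A
  override f d v x d′ w with side? d′ d | w ≟ v
  ... | yes _ | yes _ = x
  ... | yes _ | no _  = f d′ w
  ... | no _  | _     = f d′ w

  -- The value is an argument of `P`, so the comparison of positions is made here once and its users
  -- treat only the new entry and the untouched ones.
  override-elim : (P : Side → Fin n → A → Set) → ∀ {f d v x} → P d v x →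
                  (∀ {d′ w} → d′ ≢ d ⊎ w ≢ v → P d′ w (f d′ w)) → ∀ d′ w → P d′ w (override f d v x d′ w)
  override-elim P {d = d} {v} new old d′ w with side? d′ d | w ≟ v
  ... | yes refl | yes refl = new
  ... | yes _    | no w≢v   = old (inj₂ w≢v)
  ... | no d′≢d  | _        = old (inj₁ d′≢d)

  override-same : ∀ f d v x → override f d v x d v ≡ x
  override-same f d v x with side? d d | v ≟ v
  ... | yes _  | yes _  = refl
  ... | yes _  | no v≢v = contradiction refl v≢v
  ... | no d≢d | _      = contradiction refl d≢d

  override-other : ∀ {f d v x d′ w} → d′ ≢ d ⊎ w ≢ v → override f d v x d′ w ≡ f d′ w
  override-other {d = d} {v} {d′ = d′} {w} other with side? d′ d | w ≟ v
  ... | yes refl | yes refl = [ contradiction refl , contradiction refl ]′ other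
  ... | yes _    | no _     = refl
  ... | no _     | _        = refl

sumFin : ∀ {n} → (Fin n → ℕ) → ℕ
sumFin {zero}  f = 0
sumFin {suc n} f = f fzero + sumFin (f ∘ fsuc)

sumFin-cong : ∀ {n} {f g : Fin n → ℕ} → (∀ v → f v ≡ g v) → sumFin f ≡ sumFin g
sumFin-cong {zero}  eq = refl
sumFin-cong {suc n} eq = cong₂ _+_ (eq fzero) (sumFin-cong (eq ∘ fsuc))

-- A balance of two sums, which avoids truncated subtraction.
sumFin-update : ∀ {n} {f g : Fin n → ℕ} v → (∀ w → w ≢ v → f w ≡ g w) → sumFin f + g v ≡ sumFin g + f v
sumFin-update {suc n} {f} {g} fzero eq
  rewrite sumFin-cong {f = f ∘ fsuc} {g ∘ fsuc} (λ w → eq (fsuc w) λ ()) =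
  solve 3 (λ a b c → a :+ b :+ c := c :+ b :+ a) refl (f fzero) _ (g fzero)
  where open +-*-Solver
sumFin-update {suc n} {f} {g} (fsuc v) eq rewrite eq fzero (λ ()) =
  trans (+-assoc (g fzero) _ _)
    (trans (cong (g fzero +_) (sumFin-update v (λ w w≢v → eq (fsuc w) (w≢v ∘ fsuc-injective))))
      (sym (+-assoc (g fzero) _ _)))

Adjacency : ℕ → ℕ → Set
Adjacency n m = Side → Fin n → List (Fin m)

module _ {n m : ℕ} where

  total : Adjacency n m → ℕ
  total adj = sumFin (length ∘ adj tl) + sumFin (length ∘ adj hd)

  total-override : ∀ adj d v xs → total (override adj d v xs) + length (adj d v) ≡ total adj + length xs
  total-override adj tl v xs = begin
    X′ + Y + b ≡⟨ solve 3 (λ x y z → x :+ y :+ z := x :+ z :+ y) refl X′ Y b ⟩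
    X′ + b + Y ≡⟨ cong (_+ Y) (sumFin-update v (λ w w≢v → cong length (override-other {f = adj} {tl} {x = xs} (inj₂ w≢v)))) ⟩
    X + length (override adj tl v xs tl v) + Y ≡⟨ cong (λ ys → X + length ys + Y) (override-same adj tl v xs) ⟩
    X + a + Y  ≡⟨ solve 3 (λ x y z → x :+ y :+ z := x :+ z :+ y) refl X a Y ⟩
    X + Y + a  ∎
    where
    open +-*-Solver
    open ≡-Reasoning
    a = length xs
    b = length (adj tl v)
    X = sumFin (length ∘ adj tl)
    X′ = sumFin (length ∘ override adj tl v xs tl)
    Y = sumFin (length ∘ adj hd)
  total-override adj hd v xs = begin
    Y + X′ + b   ≡⟨ +-assoc Y X′ b ⟩
    Y + (X′ + b) ≡⟨ cong (Y +_) (sumFin-update v (λ w w≢v → cong length (override-other {f = adj} {hd} {x = xs} (inj₂ w≢v)))) ⟩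
    Y + (X + length (override adj hd v xs hd v)) ≡⟨ cong (λ ys → Y + (X + length ys)) (override-same adj hd v xs) ⟩
    Y + (X + a)  ≡⟨ +-assoc Y X a ⟨
    Y + X + a    ∎
    where
    open ≡-Reasoning
    a = length xs
    b = length (adj hd v)
    X = sumFin (length ∘ adj hd)
    X′ = sumFin (length ∘ override adj hd v xs hd)
    Y = sumFin (length ∘ adj tl)

  total-[] : total (λ _ _ → []) ≡ 0
  total-[] = cong₂ _+_ (zeros n) (zeros n)
    where
    zeros : ∀ k → sumFin {k} (λ _ → 0) ≡ 0
    zeros zero    = refl
    zeros (suc k) = zeros k

-- Representation of the procedure's state in memory

module _ {n m : ℕ} {G : Graph n m} (μ : Orientation G) where

  steps : Side → List (Fin m) → List ℕ
  steps d []       = []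
  steps d (e ∷ es) = toℕ e ∷ toℕ (end μ (opp d) e) ∷ steps (opp d) es

  steps-snoc : ∀ {d v es d′ v′ e} → Walk μ d v es d′ v′ →
               steps d (es ∷ʳ e) ≡ steps d es ++ toℕ e ∷ toℕ (end μ (opp d′) e) ∷ []
  steps-snoc []      = refl
  steps-snoc (_ ∷ w) = cong (λ xs → _ ∷ _ ∷ xs) (steps-snoc w)

  interleave-visited : ∀ d v es → interleave (Vec.map toℕ (v ∷ visited μ d es)) (Vec.map toℕ (Vec.fromList es))
                                ≡ toℕ v ∷ steps d es
  interleave-visited d v []       = refl
  interleave-visited d v (e ∷ es) = cong (λ xs → toℕ v ∷ toℕ e ∷ xs) (interleave-visited (opp d) _ es)

  output : List (Path n m) → List ℕ
  output = concatMap serialise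

  -- k stands in the cell reserved for the length of the path being written.
  buffer : List (Path n m) → ℕ → Side → Fin n → List (Fin m) → List ℕ
  buffer D k d v es = output D ++ k ∷ toℕ v ∷ steps d es

  buffer-snoc : ∀ {D k d v es d′ v′ e} → Walk μ d v es d′ v′ →
                buffer D k d v (es ∷ʳ e) ≡ (buffer D k d v es ∷ʳ toℕ e) ∷ʳ toℕ (end μ (opp d′) e)
  buffer-snoc {D} {k} {d} {v} {es} {d′} {_} {e} w = begin
    output D ++ k ∷ toℕ v ∷ steps d (es ∷ʳ e)      ≡⟨ cong (λ xs → output D ++ k ∷ toℕ v ∷ xs) (steps-snoc w) ⟩
    output D ++ (k ∷ toℕ v ∷ steps d es) ++ e₁ ∷ e₂ ∷ [] ≡⟨ ++-assoc (output D) _ _ ⟨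
    buffer D k d v es ++ e₁ ∷ e₂ ∷ []              ≡⟨ ++-assoc (buffer D k d v es) (e₁ ∷ []) (e₂ ∷ []) ⟨
    (buffer D k d v es ∷ʳ e₁) ∷ʳ e₂                ∎
    where
    open ≡-Reasoning
    e₁ = toℕ e
    e₂ = toℕ (end μ (opp d′) e)

  output-snoc : ∀ D {d v e es} → output (D ∷ʳ toPath μ d v e es) ≡ buffer D (suc (length es)) d v (e ∷ es)
  output-snoc D {d} {v} {e} {es} = begin
    output (D ∷ʳ P)              ≡⟨ concatMap-++ serialise D (P ∷ []) ⟩
    output D ++ serialise P ++ [] ≡⟨ cong (output D ++_) (++-identityʳ _) ⟩
    output D ++ serialise P       ≡⟨ cong (λ xs → output D ++ suc (length es) ∷ xs) (interleave-visited d v (e ∷ es)) ⟩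
    buffer D (suc (length es)) d v (e ∷ es) ∎
    where
    open ≡-Reasoning
    P = toPath μ d v e es

  record Lists (ends firsts nexts : Side → ℕ → ℕ) (adj : Adjacency n m) : Set where
    field
      ends≡  : ∀ d e → ends d (toℕ e) ≡ toℕ (end μ d e)
      linked : ∀ d v → Linked (nexts d) (firsts d (toℕ v)) (adj d v)
      sound  : ∀ d v → All (λ e → end μ d e ≡ v) (adj d v)

  ListsAt : Store → Adjacency n m → Set
  ListsAt s = Lists (pick (arr s 0) (arr s 1)) (pick (arr s 3) (arr s 4)) (pick (arr s 5) (arr s 6))

  ≢⇒≡opp : ∀ {d d′} → d′ ≢ d → d′ ≡ opp d
  ≢⇒≡opp {tl} {tl} p = contradiction refl p
  ≢⇒≡opp {tl} {hd} p = refl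
  ≢⇒≡opp {hd} {tl} p = refl
  ≢⇒≡opp {hd} {hd} p = contradiction refl p

  firsts-other : ∀ {firsts firsts′ : Side → ℕ → ℕ} {d} {v : Fin n} {x} →
                 firsts′ d ≡ update (firsts d) (toℕ v) x → firsts′ (opp d) ≡ firsts (opp d) →
                 ∀ {d′ w} → d′ ≢ d ⊎ w ≢ v → firsts′ d′ (toℕ w) ≡ firsts d′ (toℕ w)
  firsts-other same other (inj₁ d′≢d) with ≢⇒≡opp d′≢d
  ... | refl = cong (λ f → f (toℕ _)) other
  firsts-other {firsts} {d = d} same other {d′} (inj₂ w≢v) with side? d′ d
  ... | yes refl = trans (cong (λ f → f (toℕ _)) same) (update-other (firsts d) _ (w≢v ∘ toℕ-injective))
  ... | no d′≢d with ≢⇒≡opp d′≢d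
  ...   | refl = cong (λ f → f (toℕ _)) other

  -- Only a head pointer moves. The next pointers stay fixed, so all other lists are read off the
  -- memory exactly as before.
  unlink-lists : ∀ {ends firsts firsts′ nexts adj} d {v e es} → Lists ends firsts nexts adj → adj d v ≡ e ∷ es →
                 firsts′ d ≡ update (firsts d) (toℕ v) (nexts d (toℕ e)) → firsts′ (opp d) ≡ firsts (opp d) →
                 Lists ends firsts′ nexts (override adj d v es)
  unlink-lists {firsts = firsts} {firsts′} {nexts} {adj} d {v} {e} {es} l eq same other = record
    { ends≡  = ends≡
    ; linked = override-elim (λ d′ w → Linked (nexts d′) (firsts′ d′ (toℕ w)))
        (subst (λ h → Linked (nexts d) h es)
          (sym (trans (cong (λ f → f (toℕ v)) same) (update-same (firsts d) {toℕ v} _ refl)))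
          (proj₂ (subst (Linked (nexts d) _) eq (linked d v))))
        (λ {d′} {w} o → subst (λ h → Linked (nexts d′) h _) (sym (firsts-other {firsts} same other o)) (linked d′ w))
    ; sound  = override-elim (λ d′ w → All (λ e → end μ d′ e ≡ w))
        (All.tail (subst (All _) eq (sound d v))) (λ _ → sound _ _)
    } where open Lists l

  -- Only a list that runs through `e` reads the next pointer of `e`.
  linked-fresh : ∀ {next next′ : ℕ → ℕ} {e : Fin m} {x} → next′ ≡ update next (toℕ e) x →
                 ∀ {h} es → All (_≢ e) es → Linked next h es → Linked next′ h es
  linked-fresh eq []       _            h       = h
  linked-fresh {next} refl (f ∷ es) (f≢e ∷ fresh) (h , l) =
    h , subst (λ h → Linked _ h es) (sym (update-other next _ (f≢e ∘ toℕ-injective))) (linked-fresh refl es fresh l)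

  link-lists : ∀ {ends firsts firsts′ nexts nexts′ adj} d {e} → Lists ends firsts nexts adj →
               (∀ v → All (_≢ e) (adj d v)) →
               nexts′ d ≡ update (nexts d) (toℕ e) (firsts d (toℕ (end μ d e))) → nexts′ (opp d) ≡ nexts (opp d) →
               firsts′ d ≡ update (firsts d) (toℕ (end μ d e)) (suc (toℕ e)) → firsts′ (opp d) ≡ firsts (opp d) →
               Lists ends firsts′ nexts′ (override adj d (end μ d e) (e ∷ adj d (end μ d e)))
  link-lists {firsts = firsts} {firsts′} {nexts} {nexts′} {adj} d {e} l fresh nsame nother fsame fother = record
    { ends≡  = ends≡
    ; linked = override-elim (λ d′ w → Linked (nexts′ d′) (firsts′ d′ (toℕ w)))
        ( trans (cong (λ f → f (toℕ v)) fsame) (update-same (firsts d) {toℕ v} _ refl)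
        , subst (λ h → Linked (nexts′ d) h (adj d v))
            (sym (trans (cong (λ f → f (toℕ e)) nsame) (update-same (nexts d) {toℕ e} _ refl))) (keep d v) )
        (λ {d′} {w} o → subst (λ h → Linked (nexts′ d′) h _) (sym (firsts-other {firsts} fsame fother o)) (keep d′ w))
    ; sound  = override-elim (λ d′ w → All (λ e → end μ d′ e ≡ w)) (refl ∷ sound d v) (λ _ → sound _ _)
    }
    where
    open Lists l
    v = end μ d e
    keep : ∀ d′ w → Linked (nexts′ d′) (firsts d′ (toℕ w)) (adj d′ w)
    keep d′ w with side? d′ d
    ... | yes refl = linked-fresh nsame _ (fresh w) (linked d w)
    ... | no d′≢d with ≢⇒≡opp d′≢d
    ...   | refl = subst (λ f → Linked f _ _) (sym nother) (linked d′ w)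

  Marked : (ℕ → ℕ) → Subset m → Set
  Marked used free = ∀ e → (used (toℕ e) ≡ 0 × e ∈ free) ⊎ (used (toℕ e) ≡ 1 × e ∉ free)

  mark : ∀ {used free} e → Marked used free → Marked (update used (toℕ e) 1) (free - e)
  mark {used} {free} e marked f with f ≟ e
  ... | yes refl = inj₂ (update-same used 1 refl , ∉-removed free)
  ... | no f≢e rewrite update-other used {toℕ e} {toℕ f} 1 (f≢e ∘ toℕ-injective) with marked f
  ...   | inj₁ (p , f∈) = inj₁ (p , x∈p∧x≢y⇒x∈p-y f∈ f≢e)
  ...   | inj₂ (p , f∉) = inj₂ (p , ∉-remove e f∉)

  Complete : Subset m → Adjacency n m → Set
  Complete free adj = ∀ d {e} → e ∈ free → e ∈ˡ adj d (end μ d e)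

  -- The parameters are single registers and arrays instead of a store, so that writes elsewhere
  -- leave the type unchanged by computation. On exit, `passed` is what empties `free`.
  record Base (paths size cursor : ℕ) (ends firsts nexts : Side → ℕ → ℕ) (used : ℕ → ℕ)
              (D : List (Path n m)) (F free : Subset m) (adj : Adjacency n m) : Set where
    field
      paths≡    : paths ≡ length D
      size≡     : size ≡ m
      lists     : Lists ends firsts nexts adj
      complete  : Complete free adj
      marked    : Marked used free
      passed    : ∀ {e} → toℕ e < cursor → e ∉ free
      reachable : Reachable μ (D , F)

  -- The marks are a separate argument so that they can run ahead of the store, as is required
  -- between `unlink` and `push`.
  BaseWith : Store → (ℕ → ℕ) → List (Path n m) → Subset m → Subset m → Adjacency n m → Set
  BaseWith s = Base (reg s rPaths) (reg s rSize) (reg s rCursor)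
                    (pick (arr s 0) (arr s 1)) (pick (arr s 3) (arr s 4)) (pick (arr s 5) (arr s 6))

  BaseAt : Store → List (Path n m) → Subset m → Subset m → Adjacency n m → Set
  BaseAt s = BaseWith s (arr s aUsed)

  base-take : ∀ {p c k ends firsts nexts used D F free adj e i} → Base p c k ends firsts nexts used D F free adj →
              i ≡ toℕ e → Base p c k ends firsts nexts (update used i 1) D F (free - e) adj
  base-take {used = used} {free = free} {e = e} b refl = record
    { Base b
    ; complete = λ d f∈ → Base.complete b d (p─q⊆p free ⁅ e ⁆ f∈)
    ; marked   = mark {used} e (Base.marked b)
    ; passed   = λ lt → ∉-remove e (Base.passed b lt)
    }

  At : Store → Side → Fin n → Set
  At s d v = reg s rSide ≡ code d × reg s rSite ≡ toℕ v

  StackAt : Store → List (Fin m) → Set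
  StackAt s st = reg s rTop ≡ length st × Stacked (arr s aStack) st

  WrittenAt : Store → List ℕ → Set
  WrittenAt s = Written (arr s aOut) (reg s rOut)

  -- The index counts iterations already paid for by the edges taken. Edges found
  -- while extending the second end also pass through the stack, so that
  -- emitting is the only mode that writes them.
  data Mode (s : Store) (D : List (Path n m)) (F free : Subset m) : ℕ → Set where
    idle     : reg s rMode ≡ 0 → WrittenAt s (output D) → Trail F free [] → Mode s D F free 0
    walking  : ∀ {d v st d′ v′} → reg s rCursor < m → reg s rMode ≡ 1 → At s d v → StackAt s st →
               WrittenAt s (output D) →
               Walk μ d v st d′ v′ → Trail F free st → st ≢ [] →
               Mode s D F free (2 + length st)
    emitting : ∀ {k d₀ v₀ es d v st d′ v′} → reg s rCursor < m → reg s rMode ≡ 2 → At s d v → StackAt s st →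
               WrittenAt s (buffer D k d₀ v₀ es) → reg s rSlot ≡ length (output D) → reg s rLen ≡ length es →
               Walk μ d₀ v₀ es d v → Walk μ d v st d′ v′ →
               Trail F free (es ++ st) → es ++ st ≢ [] → Exhausted μ F d₀ v₀ (es ++ st) →
               Mode s D F free (1 + length st)

  -- Every round of the main loop keeps the invariant and lowers the measure

  measure : Store → Subset m → Adjacency n m → ℕ → ℕ
  measure s free adj j = 4 * ∣ free ∣ + ((m ∸ reg s rCursor) + (total adj + j))

  data Inv : ℕ → Store → Set where
    inv : ∀ {s D F free adj j} → BaseAt s D F free adj → Mode s D F free j → Inv (measure s free adj j) s

  Next : ℕ → Store → Set
  Next k s = ∃[ k′ ] (k′ < k × Inv k′ s)

  -- The factor 4 comes from the seed of a path, which raises the credit from 0 to 3: one unit each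
  -- for `open-record`, for its own `pop` and for `close-record`. The fourth unit pays for the
  -- taking itself.
  take-decreases : ∀ {x x′ z z′ j j′} y → x′ < x → z′ ≤ z → j′ ≤ 3 + j →
                   4 * x′ + (y + (z′ + j′)) < 4 * x + (y + (z + j))
  take-decreases {x} {x′} {z} {z′} {j} {j′} y x′<x z′≤z j′≤ = begin-strict
    4 * x′ + (y + (z′ + j′))      ≤⟨ +-monoʳ-≤ (4 * x′) (+-monoʳ-≤ y (+-mono-≤ z′≤z j′≤)) ⟩
    4 * x′ + (y + (z + (3 + j)))  <⟨ n<1+n _ ⟩
    suc (4 * x′ + (y + (z + (3 + j)))) ≡⟨ solve 4 (λ x y z j →
      con 1 :+ (con 4 :* x :+ (y :+ (z :+ (con 3 :+ j)))) := con 4 :* (con 1 :+ x) :+ (y :+ (z :+ j))) refl x′ y z j ⟩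
    4 * suc x′ + (y + (z + j))    ≤⟨ +-monoˡ-≤ _ (*-monoʳ-≤ 4 x′<x) ⟩
    4 * x + (y + (z + j))         ∎
    where
    open ≤-Reasoning
    open +-*-Solver

  override-shorter : ∀ {adj : Adjacency n m} d v {e es} → adj d v ≡ e ∷ es → total (override adj d v es) < total adj
  override-shorter {adj} d v {e} {es} eq = +-cancelʳ-≤ (length es) _ _ (≤-reflexive (begin
    suc (total (override adj d v es) + length es) ≡⟨ +-suc (total (override adj d v es)) _ ⟨
    total (override adj d v es) + suc (length es) ≡⟨ cong (λ xs → total (override adj d v es) + length xs) eq ⟨
    total (override adj d v es) + length (adj d v) ≡⟨ total-override adj d v es ⟩
    total adj + length es ∎))
    where open ≡-Reasoning

  after-bySide : ∀ {P s} p d → reg s rSide ≡ code d → After P (p d) s → After P (bySide p) s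
  after-bySide p tl eq = after-true (≡ᵇ-true eq)
  after-bySide p hd eq = after-false (cong (_≡ᵇ 0) eq)

  complete-unlink : ∀ {free adj} d {v e es} → Complete free adj → adj d v ≡ e ∷ es → e ∉ free →
                    Complete free (override adj d v es)
  complete-unlink {free} {adj} d {v} {e} {es} complete eq e∉ d′ {f} f∈ =
    override-elim (λ d″ w xs → f ∈ˡ adj d″ w → f ∈ˡ xs)
      (λ f∈adj → Any.tail (λ { refl → e∉ f∈ }) (subst (f ∈ˡ_) eq f∈adj)) (λ _ → id) d′ _ (complete d′ f∈)

  base-unlink : ∀ {p c k ends firsts firsts′ nexts used D F free adj} d {v e es} →
                Base p c k ends firsts nexts used D F free adj → adj d v ≡ e ∷ es → e ∉ free →
                firsts′ d ≡ update (firsts d) (toℕ v) (nexts d (toℕ e)) → firsts′ (opp d) ≡ firsts (opp d) →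
                Base p c k ends firsts′ nexts used D F free (override adj d v es)
  base-unlink d b eq e∉ same other = record
    { Base b
    ; lists    = unlink-lists d (Base.lists b) eq same other
    ; complete = complete-unlink d (Base.complete b) eq e∉
    }

  unlink-at : ∀ d s {used D F free adj v e es} → BaseWith s used D F free adj → adj d v ≡ e ∷ es → e ∉ free →
              reg s rSite ≡ toℕ v → pred (arr s (aFirst d) (reg s rSite)) ≡ toℕ e →
              BaseWith (run (unlink d) s) used D F free (override adj d v es)
  unlink-at tl s b eq e∉ v≡ e≡ =
    base-unlink tl b eq e∉ (cong₂ (update (arr s 3)) v≡ (cong (arr s 5) e≡)) refl
  unlink-at hd s b eq e∉ v≡ e≡ =
    base-unlink hd b eq e∉ (cong₂ (update (arr s 4)) v≡ (cong (arr s 6) e≡)) refl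

  -- `aFirst d` is stuck while `d` is a variable; this equation and the next ones supply by cases
  -- what would otherwise compute.
  first-at : ∀ d s → arr s (aFirst d) ≡ pick (arr s 3) (arr s 4) d
  first-at tl s = refl
  first-at hd s = refl

  end-at : ∀ d s → arr s (aEnd d) ≡ pick (arr s 0) (arr s 1) d
  end-at tl s = refl
  end-at hd s = refl

  out-unlink : ∀ d s → arr (run (unlink d) s) aOut ≡ arr s aOut
  out-unlink tl s = refl
  out-unlink hd s = refl

  used-unlink : ∀ d s → arr (run (unlink d) s) aUsed ≡ arr s aUsed
  used-unlink tl s = refl
  used-unlink hd s = refl

  stack-unlink : ∀ d s → arr (run (unlink d) s) aStack ≡ arr s aStack
  stack-unlink tl s = refl
  stack-unlink hd s = refl

  after-scan : ∀ {P stuck taken} d s {D F free adj v st} →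
    BaseAt s D F free adj → reg s rSite ≡ toℕ v → StackAt s st →
    (adj d v ≡ [] → After P stuck s) →
    (let s₁ = run (unlink d) s in
      ∀ {adj′} → BaseAt s₁ D F free adj′ → total adj′ < total adj →
      arr s₁ aOut ≡ arr s aOut → StackAt s₁ st → P s₁) →
    (let s₂ = run push (run (unlink d) s) in
      ∀ {adj′ e} → BaseAt s₂ D F (free - e) adj′ → total adj′ < total adj →
      e ∈ free → end μ d e ≡ v → reg s₂ rEdge ≡ toℕ e →
      arr s₂ aOut ≡ arr s aOut → StackAt s₂ (e ∷ st) → After P taken s₂) →
    After P (scan d stuck taken) s
  after-scan {P} {stuck} {taken} d s {D} {F} {free} {adj} {v} {st} b v≡ (top≡ , stacked) onStuck onSkip onTake =
    cases (adj d v) refl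
    where
    open Base b
    open Lists lists
    s₁ = run (unlink d) s
    first≡ : arr s (aFirst d) (reg s rSite) ≡ pick (arr s 3) (arr s 4) d (toℕ v)
    first≡ = cong₂ (λ f i → f i) (first-at d s) v≡
    stack₁ : Stacked (arr s₁ aStack) st
    stack₁ = subst (λ f → Stacked f st) (sym (stack-unlink d s)) stacked
    cases : ∀ xs → adj d v ≡ xs → After P (scan d stuck taken) s
    cases [] eq = after-true (≡ᵇ-true (trans first≡ (subst (Linked _ _) eq (linked d v)))) (onStuck eq)
    cases (e ∷ es) eq = after-false (cong (_≡ᵇ 0) h≡) (after-seq (taking (marked e)))
      where
      h≡ : arr s (aFirst d) (reg s rSite) ≡ suc (toℕ e)
      h≡ = trans first≡ (proj₁ (subst (Linked _ _) eq (linked d v)))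
      e≡ : reg s₁ rEdge ≡ toℕ e
      e≡ = cong pred h≡
      used≡ : arr s₁ aUsed (reg s₁ rEdge) ≡ arr s aUsed (toℕ e)
      used≡ = cong₂ (λ f i → f i) (used-unlink d s) e≡
      taking : (arr s aUsed (toℕ e) ≡ 0 × e ∈ free) ⊎ (arr s aUsed (toℕ e) ≡ 1 × e ∉ free) →
               After P (cond (at aUsed (var rEdge) == lit 0) (push ⨾ taken) skip) s₁
      -- The program unlinks the edge before marking it, but `Complete` fails in between. The proof
      -- marks it beforehand and commutes the two writes, which concern different arrays.
      taking (inj₁ (p , e∈)) = after-true (≡ᵇ-true (trans used≡ p))
        (after-seq (onTake
          (subst (λ u → BaseWith s₁ u D F (free - e) (override adj d v es))
            (cong (λ f → update f (reg s₁ rEdge) 1) (sym (used-unlink d s)))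
            (unlink-at d s (base-take b e≡) eq (∉-removed free) v≡ e≡))
          (override-shorter {adj} d v eq) e∈ (All.head (subst (All _) eq (sound d v))) e≡ (out-unlink d s)
          (cong suc top≡ , stacked-push stack₁ top≡ e≡)))
      taking (inj₂ (p , e∉)) = after-false (cong (_≡ᵇ 0) (trans used≡ p))
        (after (onSkip
          (subst (λ u → BaseWith s₁ u D F free (override adj d v es)) (sym (used-unlink d s)) (unlink-at d s b eq e∉ v≡ e≡))
          (override-shorter {adj} d v eq) (out-unlink d s) (top≡ , stack₁)))

  Step : ℕ → Program → Store → Set
  Step k = After (Next k)

  fewer : ∀ s free {adj adj′ j} → total {n} {m} adj′ < total adj → measure s free adj′ j < measure s free adj j
  fewer s free {j = j} lt = +-monoʳ-< (4 * ∣ free ∣) (+-monoʳ-< (m ∸ reg s rCursor) (+-monoˡ-< j lt))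

  sooner : ∀ s free adj {j j′} → j′ < j → measure s free adj j′ < measure s free adj j
  sooner s free adj lt = +-monoʳ-< (4 * ∣ free ∣) (+-monoʳ-< (m ∸ reg s rCursor) (+-monoʳ-< (total adj) lt))

  step : ∀ {k k′ p s} → k′ < k → Inv k′ (run p s) → Step k p s
  step lt i = after (_ , lt , i)

  idle-step : ∀ s {D F free adj} → BaseAt s D F free adj → holds more s ≡ true →
              WrittenAt s (output D) → Trail F free [] → reg s rMode ≡ 0 →
              Step (measure s free adj 0) idleStep s
  idle-step s {D} {F} {free} {adj} b test written trail mode≡ = cases (marked e)
    where
    open Base b
    c<m : reg s rCursor < m
    c<m = subst (reg s rCursor <_) size≡ (<ᵇ-true test)
    e = fromℕ< c<m
    c≡ : reg s rCursor ≡ toℕ e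
    c≡ = sym (toℕ-fromℕ< c<m)
    cases : (arr s aUsed (toℕ e) ≡ 0 × e ∈ free) ⊎ (arr s aUsed (toℕ e) ≡ 1 × e ∉ free) →
            Step (measure s free adj 0) idleStep s
    cases (inj₁ (p , e∈)) = after-true (≡ᵇ-true (trans (cong (arr s aUsed) c≡) p))
      (step (take-decreases (m ∸ reg s rCursor) (x∈p⇒∣p-x∣<∣p∣ e∈) ≤-refl ≤-refl)
        (inv (base-take b c≡)
          (walking {d = hd} {v = end μ hd e} {st = e ∷ []} {d′ = tl} c<m refl
            (refl , trans (cong (arr s 1) c≡) (Lists.ends≡ lists hd e)) (refl , (c≡ , tt)) written
            (refl ∷ []) (trail-cons trail e∈) (λ ()))))
    cases (inj₂ (p , e∉)) = after-false (cong (_≡ᵇ 0) (trans (cong (arr s aUsed) c≡) p))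
      (step (+-monoʳ-< (4 * ∣ free ∣) (+-monoˡ-< (total adj + 0) (∸-monoʳ-< (n<1+n (reg s rCursor)) c<m)))
        (inv (record { Base b ; passed = λ lt → passed′ (m≤n⇒m<n∨m≡n (s≤s⁻¹ lt)) }) (idle mode≡ written trail)))
      where
      passed′ : ∀ {f} → toℕ f < reg s rCursor ⊎ toℕ f ≡ reg s rCursor → f ∉ free
      passed′ (inj₁ lt) = passed lt
      passed′ (inj₂ eq) with toℕ-injective (trans eq c≡)
      ... | refl = e∉

  -- The walk is held from the current half backwards, so the top of the stack is its first edge.
  -- Taking an edge is `walk-back`, and when the walk is stuck the stack already lists the path from
  -- its start.
  walk-step : ∀ s {D F free adj d v st d′ v′} → BaseAt s D F free adj →
              reg s rCursor < m → reg s rMode ≡ 1 → At s d v → StackAt s st → WrittenAt s (output D) →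
              Walk μ d v st d′ v′ → Trail F free st → st ≢ [] →
              Step (measure s free adj (2 + length st)) walkStep s
  walk-step s {D} {F} {free} {adj} {d} {v} {st} b c<m mode≡ (side≡ , site≡) stack written walk trail st≢[] =
    after-bySide walkSide d side≡ (after-scan d s b site≡ stack onStuck onSkip onTake)
    where
    onStuck : adj d v ≡ [] → Step (measure s free adj (2 + length st)) open-record s
    onStuck eq = step (sooner s free adj (n<1+n _)) (inv b
      (emitting {k = 0} {es = []} c<m refl (side≡ , site≡) stack
        (subst (Written _ _) (++-assoc (output D) (0 ∷ []) (toℕ v ∷ []))
          (written-push (written-push written refl) site≡))
        (proj₂ written) refl [] walk trail st≢[] (exhausted μ d v trail none)))
      where
      -- By `Complete`, a free edge at this half would still be in its list.
      none : ∀ {f} → f ∈ free → end μ d f ≢ v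
      none f∈ refl with subst (_ ∈ˡ_) eq (Base.complete b d f∈)
      ... | ()
    onSkip : let s₁ = run (unlink d) s in
             ∀ {adj′} → BaseAt s₁ D F free adj′ → total adj′ < total adj →
             arr s₁ aOut ≡ arr s aOut → StackAt s₁ st → Next (measure s free adj (2 + length st)) s₁
    onSkip {adj′} b₁ lt out≡ stack₁ = _ , fewer s free {adj} {adj′} lt ,
      inv b₁ (walking c<m mode≡ (side≡ , site≡) stack₁
        (subst (λ f → Written f (reg s rOut) (output D)) (sym out≡) written) walk trail st≢[])
    onTake : let s₂ = run push (run (unlink d) s) in
             ∀ {adj′ e} → BaseAt s₂ D F (free - e) adj′ → total adj′ < total adj →
             e ∈ free → end μ d e ≡ v → reg s₂ rEdge ≡ toℕ e →
             arr s₂ aOut ≡ arr s aOut → StackAt s₂ (e ∷ st) →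
             Step (measure s free adj (2 + length st)) (cross d) s₂
    onTake {e = e} b₂ lt e∈ end≡ e≡ out≡ stack₂ =
      step (take-decreases (m ∸ reg s rCursor) (x∈p⇒∣p-x∣<∣p∣ e∈) (<⇒≤ lt) (s≤s (m≤n+m _ 2)))
      (inv b₂ (walking c<m mode≡
        (refl , trans (cong₂ (λ f i → f i) (end-at (opp d) (run push (run (unlink d) s))) e≡)
                      (Lists.ends≡ (Base.lists b₂) (opp d) e))
        stack₂ (subst (λ f → Written f (reg s rOut) (output D)) (sym out≡) written)
        (walk-back μ d end≡ walk) (trail-cons trail e∈) (λ ())))

  -- An edge moves from the unwritten part `e ∷ st` to the written part `es`. The whole trail is
  -- only reassociated, so distinctness and exhaustion of the start carry over.
  pop-step : ∀ s {D F free adj k d₀ v₀ es d v e st d′ v′} → BaseAt s D F free adj →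
             reg s rCursor < m → reg s rMode ≡ 2 → StackAt s (e ∷ st) →
             WrittenAt s (buffer D k d₀ v₀ es) → reg s rSlot ≡ length (output D) → reg s rLen ≡ length es →
             Walk μ d₀ v₀ es d v → Walk μ d v (e ∷ st) d′ v′ →
             Trail F free (es ++ e ∷ st) → Exhausted μ F d₀ v₀ (es ++ e ∷ st) →
             Step (measure s free adj (2 + length st)) (pop d) s
  pop-step s {D} {F} {free} {adj} {k} {d₀} {v₀} {es} {d} {v} {e} {st}
           b c<m mode≡ (top≡ , e≡ , stacked) written slot≡ len≡ done (end≡ ∷ todo) trail exh =
    step (sooner s free adj (n<1+n _)) (inv b
      (emitting {k = k} {es = es ∷ʳ e} c<m mode≡ (refl , v≡) (cong pred top≡ , stacked)
        (subst (Written _ _) (sym (buffer-snoc {D} {k} done)) (written-push (written-push written edge≡) v≡))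
        slot≡ (trans (cong suc len≡) (sym (trans (length-++ es) (+-comm (length es) 1))))
        (walk-snoc μ done end≡) todo
        (subst (Trail F free) assoc trail)
        (λ eq → nonempty es (trans assoc eq))
        (subst (λ T → Exhausted μ F d₀ v₀ T) assoc exh)))
    where
    assoc : es ++ e ∷ st ≡ (es ∷ʳ e) ++ st
    assoc = sym (++-assoc es (e ∷ []) st)
    nonempty : ∀ xs → xs ++ e ∷ st ≢ []
    nonempty []      ()
    nonempty (_ ∷ _) ()
    edge≡ : arr s aStack (pred (reg s rTop)) ≡ toℕ e
    edge≡ = trans (cong (arr s aStack ∘ pred) top≡) e≡
    v≡ : arr s (aEnd (opp d)) (arr s aStack (pred (reg s rTop))) ≡ toℕ (end μ (opp d) e)
    v≡ = trans (cong₂ (λ f i → f i) (end-at (opp d) s) edge≡) (Lists.ends≡ (Base.lists b) (opp d) e)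

  -- This is where a full `Iteration` is recorded: `F` loses all edges of the path at once and
  -- thereby catches up with `free`, which lost them one by one and does not change here.
  close-step : ∀ s {D F free adj k d₀ v₀ e es d v} → BaseAt s D F free adj →
               WrittenAt s (buffer D k d₀ v₀ (e ∷ es)) → reg s rSlot ≡ length (output D) → reg s rLen ≡ suc (length es) →
               Walk μ d₀ v₀ (e ∷ es) d v → Trail F free (e ∷ es) → Exhausted μ F d₀ v₀ (e ∷ es) →
               adj d v ≡ [] → Step (measure s free adj 1) close-record s
  close-step s {D} {F} {free} {adj} {k} {d₀} {v₀} {e} {es} {d} {v} b (seg , out≡) slot≡ len≡ walk trail exh empty =
    step (sooner s free adj (n<1+n _)) (inv base (idle refl written trail′))
    where
    open Base b
    P = toPath μ d₀ v₀ e es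
    max : IsMaximalADPath μ F P
    max = toPath-maximal μ walk trail exh (exhausted μ d v trail none)
      where
      none : ∀ {f} → f ∈ free → end μ d f ≢ v
      none f∈ refl with subst (_ ∈ˡ_) empty (complete d f∈)
      ... | ()
    base : BaseAt (run close-record s) (D ∷ʳ P) (F ─ edgeSet P) free adj
    base = record
      { Base b
      ; paths≡    = trans (cong suc paths≡) (sym (trans (length-++ D) (+-comm (length D) 1)))
      ; reachable = reachable ◅◅ (iterate (e , All.head (Trail.inF trail)) max ◅ ε)
      }
    written : WrittenAt (run close-record s) (output (D ∷ʳ P))
    written = subst (Written _ _) (sym (output-snoc D))
      ( seg-replace (output D) seg slot≡ len≡
      , trans out≡ (trans (length-++ (output D)) (sym (length-++ (output D)))) )
    trail′ : Trail (F ─ edgeSet P) free []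
    trail′ = record
      { distinct = [] ; inF = [] ; spent = []
      ; free⊆F   = λ f∈ → ∈─edgeSet⁺ P (Trail.free⊆F trail f∈) (λ f∈P → All.lookup (Trail.spent trail) (∈-fromList⁻ f∈P) f∈)
      ; cover    = λ f∈ → let f∈F , f∉P = ∈─edgeSet⁻ P f∈ in
                   [ inj₁ , (λ f∈T → contradiction (∈-fromList⁺ f∈T) f∉P) ]′ (Trail.cover trail f∈F)
      }

  emit-step : ∀ s {D F free adj k d₀ v₀ es d v st d′ v′} → BaseAt s D F free adj →
              reg s rCursor < m → reg s rMode ≡ 2 → At s d v → StackAt s st →
              WrittenAt s (buffer D k d₀ v₀ es) → reg s rSlot ≡ length (output D) → reg s rLen ≡ length es →
              Walk μ d₀ v₀ es d v → Walk μ d v st d′ v′ →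
              Trail F free (es ++ st) → es ++ st ≢ [] → Exhausted μ F d₀ v₀ (es ++ st) →
              Step (measure s free adj (1 + length st)) emitStep s
  emit-step s {d = d} {st = _ ∷ _} b c<m mode≡ pos stack written slot≡ len≡ done todo trail _ exh =
    after-bySide emitSide d (proj₁ pos) (after-false (cong (_≡ᵇ 0) (proj₁ stack))
      (pop-step s b c<m mode≡ stack written slot≡ len≡ done todo trail exh))
  emit-step s {es = []} {st = []} _ _ _ _ _ _ _ _ _ _ _ []≢[] _ = contradiction refl []≢[]
  emit-step s {D} {F} {free} {adj} {k} {d₀} {v₀} {e₀ ∷ es} {d} {v} {[]}
            b c<m mode≡ (side≡ , site≡) stack written slot≡ len≡ done [] trail _ exh =
    after-bySide emitSide d side≡ (after-true (≡ᵇ-true (proj₁ stack))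
      (after-scan d s b site≡ stack onStuck onSkip onTake))
    where
    T≡ : e₀ ∷ es ++ [] ≡ e₀ ∷ es
    T≡ = ++-identityʳ _
    trail₀ : Trail F free (e₀ ∷ es)
    trail₀ = subst (Trail F free) T≡ trail
    exh₀ : Exhausted μ F d₀ v₀ (e₀ ∷ es)
    exh₀ = subst (λ T → Exhausted μ F d₀ v₀ T) T≡ exh
    xs = buffer D k d₀ v₀ (e₀ ∷ es)
    onStuck : adj d v ≡ [] → Step (measure s free adj 1) close-record s
    onStuck = close-step s b written slot≡ len≡ done trail₀ exh₀
    onSkip : let s₁ = run (unlink d) s in
             ∀ {adj′} → BaseAt s₁ D F free adj′ → total adj′ < total adj →
             arr s₁ aOut ≡ arr s aOut → StackAt s₁ [] → Next (measure s free adj 1) s₁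
    onSkip {adj′} b₁ lt out≡ stack₁ = _ , fewer s free {adj} {adj′} lt ,
      inv b₁ (emitting {k = k} c<m mode≡ (side≡ , site≡) stack₁
        (subst (λ f → Written f (reg s rOut) xs) (sym out≡) written) slot≡ len≡ done [] trail (λ ()) exh)
    onTake : let s₂ = run push (run (unlink d) s) in
             ∀ {adj′ e} → BaseAt s₂ D F (free - e) adj′ → total adj′ < total adj →
             e ∈ free → end μ d e ≡ v → reg s₂ rEdge ≡ toℕ e →
             arr s₂ aOut ≡ arr s aOut → StackAt s₂ (e ∷ []) → Step (measure s free adj 1) skip s₂
    onTake b₂ lt e∈ end≡ _ out≡ stack₂ =
      step (take-decreases (m ∸ reg s rCursor) (x∈p⇒∣p-x∣<∣p∣ e∈) (<⇒≤ lt) (s≤s (s≤s z≤n)))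
      (inv b₂ (emitting {k = k} c<m mode≡ (side≡ , site≡) stack₂
        (subst (λ f → Written f (reg s rOut) xs) (sym out≡) written) slot≡ len≡ done
        (end≡ ∷ []) (trail-snoc trail₀ e∈) (λ ()) (λ f∈ p → ∈-++⁺ˡ (exh₀ f∈ p))))

  main-step : ∀ {k s} → Inv k s → holds more s ≡ true → Step k mainBody s
  main-step (inv b (idle mode≡ written trail)) test =
    after-true (≡ᵇ-true mode≡) (idle-step _ b test written trail mode≡)
  main-step (inv b (walking c<m mode≡ pos stack written walk trail st≢[])) _ =
    after-false (cong (_≡ᵇ 0) mode≡) (after-true (≡ᵇ-true mode≡)
      (walk-step _ b c<m mode≡ pos stack written walk trail st≢[]))
  main-step (inv b (emitting c<m mode≡ pos stack written slot≡ len≡ done todo trail T≢[] exh)) _ =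
    after-false (cong (_≡ᵇ 0) mode≡) (after-false (cong (_≡ᵇ 1) mode≡)
      (emit-step _ b c<m mode≡ pos stack written slot≡ len≡ done todo trail T≢[] exh))

  -- Building the linked lists

  -- `older` makes the edge under the cursor fresh, so linking it damages no list; `total≡` counts
  -- one cell for each of the two halves of an edge.
  record Building (k : ℕ) (s : Store) : Set where
    field
      {adj}    : Adjacency n m
      k≡       : k ≡ m ∸ reg s rCursor
      paths≡   : reg s rPaths ≡ 0
      size≡    : reg s rSize ≡ m
      cursor≤m : reg s rCursor ≤ m
      mode≡    : reg s rMode ≡ 0
      out≡     : reg s rOut ≡ 0
      used≡    : ∀ i → arr s aUsed i ≡ 0
      lists    : ListsAt s adj
      older    : ∀ d v → All (λ e → toℕ e < reg s rCursor) (adj d v)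
      complete : ∀ d {e} → toℕ e < reg s rCursor → e ∈ˡ adj d (end μ d e)
      total≡   : total adj ≡ reg s rCursor + reg s rCursor

  insert : Adjacency n m → Side → Fin m → Adjacency n m
  insert adj d e = override adj d (end μ d e) (e ∷ adj d (end μ d e))

  total-insert : ∀ adj d e → total (insert adj d e) ≡ suc (total adj)
  total-insert adj d e = +-cancelʳ-≡ (length (adj d v)) _ _
    (trans (total-override adj d v (e ∷ adj d v)) (+-suc (total adj) _))
    where v = end μ d e

  insert-all : ∀ {P : Fin m → Set} adj d {e} → P e → (∀ d′ w → All P (adj d′ w)) → ∀ d′ w → All P (insert adj d e d′ w)
  insert-all {P} adj d p ps = override-elim (λ _ _ → All P) (p ∷ ps d _) (λ _ → ps _ _)

  insert-old : ∀ adj d {e f d′ w} → f ∈ˡ adj d′ w → f ∈ˡ insert adj d e d′ w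
  insert-old adj d {f = f} {d′} {w} = override-elim (λ d″ w′ xs → f ∈ˡ adj d″ w′ → f ∈ˡ xs) there (λ _ → id) d′ w

  insert-new : ∀ adj d {e} → e ∈ˡ insert adj d e d (end μ d e)
  insert-new adj d {e} = subst (e ∈ˡ_) (sym (override-same adj d (end μ d e) _)) (here refl)

  link-at : ∀ d {s adj e} → ListsAt s adj → reg s rCursor ≡ toℕ e → (∀ v → All (_≢ e) (adj d v)) →
            ListsAt (run (link d) s) (insert adj d e)
  link-at tl {s} {e = e} l c≡ fresh = link-lists tl l fresh
    (cong₂ (update (arr s 5)) c≡ (cong (arr s 3) v≡)) refl (cong₂ (update (arr s 3)) v≡ (cong suc c≡)) refl
    where
    v≡ : arr s 0 (reg s rCursor) ≡ toℕ (end μ tl e)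
    v≡ = trans (cong (arr s 0) c≡) (Lists.ends≡ l tl e)
  link-at hd {s} {e = e} l c≡ fresh = link-lists hd l fresh
    (cong₂ (update (arr s 6)) c≡ (cong (arr s 4) v≡)) refl (cong₂ (update (arr s 4)) v≡ (cong suc c≡)) refl
    where
    v≡ : arr s 1 (reg s rCursor) ≡ toℕ (end μ hd e)
    v≡ = trans (cong (arr s 1) c≡) (Lists.ends≡ l hd e)

  build-step : ∀ {k s} → Building k s → holds more s ≡ true → ∃[ k′ ] (k′ < k × Building k′ (run buildBody s))
  build-step {k} {s} b test = m ∸ suc c , subst (m ∸ suc c <_) (sym k≡) (∸-monoʳ-< (n<1+n _) c<m) , record
    { adj      = insert (insert adj tl e) hd e
    ; k≡       = refl
    ; paths≡   = paths≡
    ; size≡    = size≡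
    ; cursor≤m = c<m
    ; mode≡    = mode≡
    ; out≡     = out≡
    ; used≡    = used≡
    ; lists    = link-at hd {run (link tl) s} (link-at tl {s} lists c≡ (fresh tl)) c≡ (fresh hd)
    ; older    = insert-all (insert adj tl e) hd new (insert-all adj tl new (λ d v → All.map m<n⇒m<1+n (older d v)))
    ; complete = λ d lt → complete′ d (m≤n⇒m<n∨m≡n (s≤s⁻¹ lt))
    ; total≡   = trans (total-insert (insert adj tl e) hd e)
                   (cong suc (trans (total-insert adj tl e) (trans (cong suc total≡) (sym (+-suc c c)))))
    }
    where
    open Building b
    c = reg s rCursor
    c<m : c < m
    c<m = subst (c <_) size≡ (<ᵇ-true test)
    e = fromℕ< c<m
    c≡ : c ≡ toℕ e
    c≡ = sym (toℕ-fromℕ< c<m)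
    new : toℕ e < suc c
    new = s≤s (≤-reflexive (sym c≡))
    fresh : ∀ d v → All (_≢ e) (adj d v)
    fresh d v = All.map (λ { lt refl → <-irrefl (sym c≡) lt }) (older d v)
    complete′ : ∀ d {f} → toℕ f < c ⊎ toℕ f ≡ c → f ∈ˡ insert (insert adj tl e) hd e d (end μ d f)
    complete′ d {f} (inj₁ lt) = insert-old (insert adj tl e) hd {e} {d′ = d} {end μ d f}
      (insert-old adj tl {e} {d′ = d} {end μ d f} (complete d lt))
    complete′ d (inj₂ eq) with toℕ-injective (trans eq c≡)
    complete′ tl (inj₂ eq) | refl = insert-old (insert adj tl e) hd {e} {d′ = tl} {end μ tl e} (insert-new adj tl)
    complete′ hd (inj₂ eq) | refl = insert-new (insert adj tl e) hd

  building-initial : Building m (run (set rPaths (lit 0)) (input μ))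
  building-initial = record
    { adj      = λ _ _ → []
    ; k≡       = refl
    ; paths≡   = refl
    ; size≡    = refl
    ; cursor≤m = z≤n
    ; mode≡    = refl
    ; out≡     = refl
    ; used≡    = λ _ → refl
    ; lists    = record
      { ends≡  = λ { tl e → padded-tabulate _ e ; hd e → padded-tabulate _ e }
      ; linked = λ { tl v → refl ; hd v → refl }
      ; sound  = λ _ _ → []
      }
    ; older    = λ _ _ → []
    ; complete = λ _ ()
    ; total≡   = total-[] {n} {m}
    }

  -- The measure starts at `7 * m`: four per free edge, one per edge to be scanned and one for each
  -- of its two cells; the idle mode holds no credit.
  main-initial : ∀ {k s} → Building k s → holds more s ≡ false →
                 Inv (4 * m + (m + ((m + m) + 0))) (run (set rCursor (lit 0)) s)
  main-initial {s = s} b test = subst (λ k → Inv k (run (set rCursor (lit 0)) s))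
    (cong₂ (λ x y → 4 * x + (m + (y + 0))) (∣⊤∣≡n m) (trans total≡ (cong₂ _+_ c≡m c≡m)))
    (inv {D = []} {F = ⊤} {free = ⊤} {adj = adj} base (idle mode≡ (tt , out≡) trail-[]))
    where
    open Building b
    c≡m : reg s rCursor ≡ m
    c≡m = ≤-antisym cursor≤m (subst (_≤ reg s rCursor) size≡ (<ᵇ-false test))
    base : BaseAt (run (set rCursor (lit 0)) s) [] ⊤ ⊤ adj
    base = record
      { paths≡    = paths≡
      ; size≡     = size≡
      ; lists     = lists
      ; complete  = λ d {e} _ → complete d (subst (toℕ e <_) (sym c≡m) (toℕ<n e))
      ; marked    = λ e → inj₁ (used≡ (toℕ e) , ∈⊤)
      ; passed    = λ ()
      ; reachable = ε
      }

  -- The cursor stands still while a path is under construction. The active modes therefore record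
  -- that it is below `m`, which leaves only the idle mode when the loop exits; there `F` is covered
  -- by `free`, and every edge has been passed.
  main-final : ∀ {k s} → Inv k s → holds more s ≡ false → ∃[ D ] (Outputs s D × Returns μ D)
  main-final {s = s} (inv {D = D} {F} b mode) test = finish mode
    where
    open Base b
    m≤c : m ≤ reg s rCursor
    m≤c = subst (_≤ reg s rCursor) size≡ (<ᵇ-false test)
    finish : ∀ {j} → Mode s D F _ j → ∃[ D ] (Outputs s D × Returns μ D)
    finish (idle _ (seg , _) trail) = D , (paths≡ , seg⇒applyUpTo (output D) seg) , F , reachable ,
      λ (e , e∈) → [ passed (<-≤-trans (toℕ<n e) m≤c) , (λ ()) ]′ (Trail.cover trail e∈)
    finish (walking c<m _ _ _ _ _ _ _)            = contradiction (<-≤-trans c<m m≤c) (<-irrefl refl)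
    finish (emitting c<m _ _ _ _ _ _ _ _ _ _ _) = contradiction (<-≤-trans c<m m≤c) (<-irrefl refl)

-- The linear time bound

-- Two register assignments of cost 2, two failing loop tests, and per edge one round of building
-- and seven rounds of the main loop.
timeFactor : ℕ
timeFactor = 4 + 2 * costᵗ more + (costᵗ more + maxTime buildBody) + 7 * (costᵗ more + maxTime mainBody)

linear-bound : ∀ a b c m → 2 + ((a + m * b) + (2 + (a + (4 * m + (m + ((m + m) + 0))) * c))) ≤ (4 + 2 * a + b + 7 * c) * suc m
linear-bound a b c m = begin
  2 + ((a + m * b) + (2 + (a + (4 * m + (m + ((m + m) + 0))) * c)))
    ≤⟨ m≤m+n _ ((4 + 2 * a) * m + b + 7 * c) ⟩
  2 + ((a + m * b) + (2 + (a + (4 * m + (m + ((m + m) + 0))) * c))) + ((4 + 2 * a) * m + b + 7 * c)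
    ≡⟨ solve 4 (λ a b c m →
         con 2 :+ ((a :+ m :* b) :+ (con 2 :+ (a :+ (con 4 :* m :+ (m :+ ((m :+ m) :+ con 0))) :* c)))
           :+ ((con 4 :+ con 2 :* a) :* m :+ b :+ con 7 :* c)
         := (con 4 :+ con 2 :* a :+ b :+ con 7 :* c) :* (con 1 :+ m)) refl a b c m ⟩
  (4 + 2 * a + b + 7 * c) * suc m ∎
  where
  open ≤-Reasoning
  open +-*-Solver

program-correct : ∀ {n m} {G : Graph n m} (μ : Orientation G) →
  ∃[ s ] ∃[ t ] ∃[ D ] (Exec program (input μ) s t × t ≤ timeFactor * suc m × Outputs s D × Returns μ D)
program-correct {m = m} μ
  with while-rule {more} {buildBody} (Building μ) _ (build-step μ) (building-initial μ)
... | s₁ , t₁ , _ , x₁ , t₁≤ , b , exit₁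
  with while-rule {more} {mainBody} (Inv μ) _ (λ i test → result (main-step μ i test)) (main-initial μ b exit₁)
... | s₂ , t₂ , _ , x₂ , t₂≤ , i , exit₂
  with main-final μ i exit₂
... | D , outputs , returns =
  s₂ , _ , D , exec-seq exec-set (exec-seq x₁ (exec-seq exec-set x₂)) ,
  ≤-trans (+-monoʳ-≤ 2 (+-mono-≤ t₁≤ (+-monoʳ-≤ 2 t₂≤)))
    (linear-bound (costᵗ more) (costᵗ more + maxTime buildBody) (costᵗ more + maxTime mainBody) m) ,
  outputs , returns

-- Since the choice of each path is open, the procedure is treated through all its runs: they
-- terminate, cannot get stuck early and return only good decompositions. Linear time is an
-- existence claim about a program that produces one of the possible results; `suc m` leaves room
-- for constant work when there are no edges.
theorem4p4 : (∀ {n m} (G : Graph n m) (μ : Orientation G) →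
    Acc (flip (Iteration μ)) initial
    × (∀ D F → Reachable μ (D , F) → Nonempty F → ∃[ c ] Iteration μ (D , F) c)
    × (∀ D → Returns μ D →
    PartitionsEdges D
    × All (IsADPath μ) D
    × (∀ v → AtMostOne (IncomingEndpoint μ v) D)
    × (∀ v → AtMostOne (OutgoingEndpoint μ v) D)))
    × (∃[ p ] ∃[ K ] (∀ {n m} (G : Graph n m) (μ : Orientation G) →
    ∃[ s ] ∃[ t ] ∃[ D ]
    (Exec p (input μ) s t × t ≤ K * suc m × Outputs s D × Returns μ D)))
theorem4p4 =
  (λ G μ →
      terminates μ initial
    , (λ D F _ nonempty → let P , max = maximal-exists μ nonempty in _ , iterate nonempty max)
    , (λ D (F , reach , empty) →
          partitions μ reach empty , all-ad μ reach , incoming-once μ reach , outgoing-once μ reach))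
  , program , timeFactor , λ G μ → program-correct μ
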